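{- For every $n\geq 13$, $\gamma_{MB}(P_2\square P_n)=n-2$.
   Context: $P_k$ is the path on $k$ vertices and $\square$ the Cartesian product, so $P_2\square P_n$ is the $2\times n$ grid. In the Maker–Breaker domination game on a graph $G$, two players, Dominator and Staller, alternately claim previously unclaimed vertices of $G$. Dominator wins if the set of vertices he claims becomes a dominating set of $G$ (every vertex not in it has a neighbour in it); Staller wins if she claims some vertex together with all of its neighbours. In the $D$-game Dominator moves first. $\gamma_{MB}(G)$ is the minimum number of moves Dominator needs to win the $D$-game on $G$ against optimal play by Staller (who tries to postpone his win). -}

module Defs where

open import Data.Nat using (ℕ; zero; suc; _≤_)
open import Data.Fin using (Fin; toℕ)
open import Data.Product using (Σ; _×_; ∃)
open import Data.Sum using (_⊎_)
open import Data.Empty using (⊥)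
open import Data.List using (List; []; _∷_)
open import Data.List.Membership.Propositional using (_∈_; _∉_)
open import Relation.Binary.PropositionalEquality using (_≡_; _≢_)
open import Relation.Nullary using (¬_)

-- Maker–Breaker domination game on a graph with vertex type V and
-- (symmetric, irreflexive) adjacency relation Adj.
module MBGame (V : Set) (Adj : V → V → Set) where

  Dominates : List V → Set
  Dominates D = ∀ v → v ∈ D ⊎ (Σ V λ u → u ∈ D × Adj u v)

  StallerWon : List V → Set
  StallerWon S = Σ V λ v → v ∈ S × (∀ u → Adj u v → u ∈ S)

  Unclaimed : List V → List V → V → Set
  Unclaimed D S v = v ∉ D × v ∉ S

  -- DWin k D S : from the position where Dominator has claimed D,
  -- Staller has claimed S, and Dominator is to move, Dominator can
  -- force a win using at most k further moves of his own, whatever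
  -- Staller does.  After Dominator's move, if his set dominates he has
  -- won; otherwise for every reply of Staller, that reply must not
  -- make Staller win and Dominator must still be able to win in k-1.
  DWin : ℕ → List V → List V → Set
  DWin zero    D S = ⊥
  DWin (suc k) D S =
    Σ V λ v → Unclaimed D S v ×
      ( Dominates (v ∷ D)
      ⊎ (∀ u → Unclaimed (v ∷ D) S u →
            ¬ StallerWon (u ∷ S) × DWin k (v ∷ D) (u ∷ S)))

  IsγMB : ℕ → Set
  IsγMB m = DWin m [] [] × (∀ k → DWin k [] [] → m ≤ k)

GridV : ℕ → Set
GridV n = Fin 2 × Fin n

open import Data.Product using (_,_)

GridAdj : (n : ℕ) → GridV n → GridV n → Set
GridAdj n (i , j) (i' , j') =
    (i ≡ i' × (suc (toℕ j) ≡ toℕ j' ⊎ suc (toℕ j') ≡ toℕ j))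
  ⊎ (j ≡ j' × i ≢ i')

γMB-P2□P-is : ℕ → ℕ → Set
γMB-P2□P-is n m = MBGame.IsγMB (GridV n) (GridAdj n) m

{-# OPTIONS --safe #-}
-- A position is recorded as the hypergraph of the closed neighbourhoods that
-- Dominator has not hit yet, with the vertices claimed by Staller removed.
-- Once Dominator has claimed his first vertex, this hypergraph consists of a
-- left and a right side, which share only the other vertex `mid` of the first
-- column played.
--
-- Lower bound: sweeping inwards from an outer end, Staller forces Dominator to
-- spend at least one move per column, and this leaves a side of the same shape
-- in which one of the two outermost neighbourhoods is already hit (`cut`).
-- When both sides have at most three columns a finite search shows that
-- Dominator saves at most two further moves.
--
-- Upper bound: Dominator opens in the seventh column. Away from one key vertex
-- per side, any move of Staller in a six-column side has a reply after which a
-- pairing strategy with four pairs finishes that side without `mid`, and five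
-- moves suffice on the other side with `mid`. If Staller claims `mid` or the key
-- vertex of one side, Dominator gains two moves by claiming the key vertex of
-- a side that can do without `mid`. Each further column costs one pair.
module Submission where

open import Defs
open import Data.Bool using (Bool; true; false; not)
import Data.Bool.Properties as Bool
open import Data.Empty using (⊥)
open import Data.Fin using (Fin; zero; suc; toℕ; fromℕ<)
import Data.Fin.Properties as Fin
open import Data.List using (List; []; _∷_; _++_; concat; deduplicate; downFrom; filter; length; map)
open import Data.List.Properties using (++-assoc; ++-identityʳ; length-map; map-++)
open import Data.List.Membership.Propositional using (_∈_; _∉_; find)
open import Data.List.Membership.Propositional.Properties
open import Data.List.Relation.Binary.Subset.Propositional using (_⊆_)
open import Data.List.Relation.Unary.All as All using (All; all?)
open import Data.List.Relation.Unary.Any as Any using (Any; any?; here; there)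
open import Data.Nat using (ℕ; zero; suc; _+_; _∸_; _≤_; _<_; z≤n; s≤s; s≤s⁻¹; _≤?_; _<?_)
import Data.Nat.Properties as ℕ
open import Data.Product using (∃; _×_; _,_; proj₁; proj₂)
open import Data.Sum using (_⊎_; inj₁; inj₂; [_,_])
open import Data.Unit using (⊤; tt)
open import Function using (_∘_; id)
open import Relation.Binary.Definitions using (DecidableEquality; tri<; tri≈; tri>)
open import Relation.Binary.PropositionalEquality hiding ([_])
open import Relation.Nullary using (¬_; Dec; yes; no; contradiction)
open import Relation.Nullary.Decidable using (from-yes; map′; ¬?; _×-dec_; _⊎-dec_)

-- Positions as hypergraphs

-- `at s d r` lies d + 1 columns to the side s of Dominator's first vertex, in
-- the row of that vertex if r is false.
data Label : Set where
  mid : Label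
  at  : (side : Bool) (distance : ℕ) (row : Bool) → Label

infix 4 _≟_

_≟_ : DecidableEquality Label
mid      ≟ mid         = yes refl
mid      ≟ at _ _ _    = no λ ()
at _ _ _ ≟ mid         = no λ ()
at s d r ≟ at s′ d′ r′ =
  map′ (λ { (refl , refl , refl) → refl }) (λ { refl → refl , refl , refl })
       (d ℕ.≟ d′ ×-dec (r Bool.≟ r′ ×-dec s Bool.≟ s′))

open import Data.List.Membership.DecPropositional _≟_ using (_∈?_)

Edge Hypergraph : Set
Edge       = List Label
Hypergraph = List Edge

infixl 6 _∖_ _⊖_ _without_

-- Opaque, so that unification recovers H from H ∖ v.
opaque
  _without_ : Edge → Label → Edge
  h without u = filter (λ x → ¬? (x ≟ u)) h

  _⊖_ : Hypergraph → Label → Hypergraph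
  H ⊖ u = map (_without u) H

  _∖_ : Hypergraph → Label → Hypergraph
  H ∖ v = filter (λ h → ¬? (v ∈? h)) H

  support : Hypergraph → List Label
  support H = deduplicate _≟_ (concat H)

  ∈-without : ∀ {x u h} → x ∈ h → x ≢ u → x ∈ h without u
  ∈-without {u = u} = ∈-filter⁺ (λ x → ¬? (x ≟ u))

  without-⊆ : ∀ {u h} → h without u ⊆ h
  without-⊆ {u} = proj₁ ∘ ∈-filter⁻ (λ x → ¬? (x ≟ u))

  ∉-without : ∀ {u} h → u ∉ h without u
  ∉-without {u} h u∈ = proj₂ (∈-filter⁻ (λ x → ¬? (x ≟ u)) {xs = h} u∈) refl

  ∈-⊖ : ∀ {h H} u → h ∈ H → h without u ∈ H ⊖ u
  ∈-⊖ u = ∈-map⁺ (_without u)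

  ∈-⊖⁻ : ∀ {h u H} → h ∈ H ⊖ u → ∃ λ h′ → h′ ∈ H × h ≡ h′ without u
  ∈-⊖⁻ {u = u} = ∈-map⁻ (_without u)

  ∈-∖ : ∀ {h v H} → h ∈ H → v ∉ h → h ∈ H ∖ v
  ∈-∖ {v = v} = ∈-filter⁺ (λ h → ¬? (v ∈? h))

  ∈-∖⁻ : ∀ {h v H} → h ∈ H ∖ v → h ∈ H × v ∉ h
  ∈-∖⁻ {v = v} {H} = ∈-filter⁻ (λ h → ¬? (v ∈? h)) {xs = H}

  ∈-support : ∀ {x h H} → x ∈ h → h ∈ H → x ∈ support H
  ∈-support x∈h h∈H = ∈-deduplicate⁺ _≟_ (∈-concat⁺′ x∈h h∈H)

  support⁻ : ∀ {x} H → x ∈ support H → ∃ λ h → x ∈ h × h ∈ H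
  support⁻ H x∈ = ∈-concat⁻′ H (∈-deduplicate⁻ _≟_ (concat H) x∈)

infix 4 _≼_

-- Staller likes H at least as much as H′.
_≼_ : Hypergraph → Hypergraph → Set
H ≼ H′ = ∀ {h′} → h′ ∈ H′ → ∃ λ h → h ∈ H × h ⊆ h′

≼-⊇ : ∀ {H H′} → H′ ⊆ H → H ≼ H′
≼-⊇ H′⊆H h∈ = _ , H′⊆H h∈ , id

≼-refl : ∀ {H} → H ≼ H
≼-refl = ≼-⊇ id

≼-trans : ∀ {H₁ H₂ H₃} → H₁ ≼ H₂ → H₂ ≼ H₃ → H₁ ≼ H₃
≼-trans p q h₃∈ with h₂ , h₂∈ , s ← q h₃∈ with h₁ , h₁∈ , t ← p h₂∈ = h₁ , h₁∈ , s ∘ t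

≼-∖ : ∀ {H} v → H ≼ H ∖ v
≼-∖ v = ≼-⊇ (proj₁ ∘ ∈-∖⁻)

⊖-≼ : ∀ {H} u → H ⊖ u ≼ H
⊖-≼ u h∈ = _ , ∈-⊖ u h∈ , without-⊆

∖-mono : ∀ {H H′} v → H ≼ H′ → H ∖ v ≼ H′ ∖ v
∖-mono v H≼ h′∈ with h′∈ , v∉ ← ∈-∖⁻ h′∈ with h , h∈ , h⊆ ← H≼ h′∈ = h , ∈-∖ h∈ (v∉ ∘ h⊆) , h⊆

⊖-mono : ∀ {H H′} u → H ≼ H′ → H ⊖ u ≼ H′ ⊖ u
⊖-mono u H≼ h′∈ with h₀ , h₀∈ , refl ← ∈-⊖⁻ h′∈ with h , h∈ , h⊆ ← H≼ h₀∈ =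
  h without u , ∈-⊖ u h∈ , λ x∈ → ∈-without (h⊆ (without-⊆ x∈)) λ { refl → ∉-without h x∈ }

++-mono : ∀ {H₁ H₁′ H₂ H₂′} → H₁ ≼ H₁′ → H₂ ≼ H₂′ → H₁ ++ H₂ ≼ H₁′ ++ H₂′
++-mono {H₁} {H₁′} p q h∈ with ∈-++⁻ H₁′ h∈
... | inj₁ h∈₁ with h , i , s ← p h∈₁ = h , ∈-++⁺ˡ i , s
... | inj₂ h∈₂ with h , i , s ← q h∈₂ = h , ∈-++⁺ʳ H₁ i , s

++-comm-≼ : ∀ H₁ H₂ → H₁ ++ H₂ ≼ H₂ ++ H₁
++-comm-≼ H₁ H₂ h∈ with ∈-++⁻ H₂ h∈
... | inj₁ i = _ , ∈-++⁺ʳ H₁ i , id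
... | inj₂ i = _ , ∈-++⁺ˡ i , id

∖⊖-comm : ∀ {H u v} → v ≢ u → H ∖ v ⊖ u ≼ H ⊖ u ∖ v
∖⊖-comm {u = u} v≢u h∈ with h∈ , v∉ ← ∈-∖⁻ h∈ with h , i , refl ← ∈-⊖⁻ h∈ =
  _ , ∈-⊖ u (∈-∖ i λ v∈ → v∉ (∈-without v∈ v≢u)) , id

≼-∖-∉ : ∀ {H v} → v ∉ support H → H ∖ v ≼ H
≼-∖-∉ v∉ h∈ = _ , ∈-∖ h∈ (λ v∈h → v∉ (∈-support v∈h h∈)) , id

⊖-∉-≼ : ∀ {H u} → u ∉ support H → H ≼ H ⊖ u
⊖-∉-≼ u∉ h∈ with h , h∈ , refl ← ∈-⊖⁻ h∈ =
  h , h∈ , λ x∈ → ∈-without x∈ λ { refl → u∉ (∈-support x∈ h∈) }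

-- Staller keeps some edge of H unhit during the next k moves of Dominator, or
-- claims a whole edge. The suffix names the player to move.
mutual
  HoldS HoldD : ℕ → Hypergraph → Set
  HoldS k H = (∃ λ h → h ∈ H) × ∃ λ u → HoldD k (H ⊖ u)

  HoldD zero    H = ⊤
  HoldD (suc k) H = [] ∈ H ⊎ ∀ v → HoldS k (H ∖ v)

-- Dominator hits every edge of H within k moves, before Staller claims one.
-- Since Dominator's moves never remove an empty edge, [] ∉ H need not be
-- required after a move of Staller.
mutual
  CanS CanD : ℕ → Hypergraph → Set
  CanS k H = [] ∉ H × (H ≡ [] ⊎ ∀ u → CanD k (H ⊖ u))

  CanD zero    H = ⊥
  CanD (suc k) H = ∃ λ v → CanS k (H ∖ v)

⊆[]⇒≡[] : ∀ {h : Edge} → h ⊆ [] → h ≡ []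
⊆[]⇒≡[] {[]}    _ = refl
⊆[]⇒≡[] {x ∷ h} s = contradiction (s (here refl)) λ ()

[]∈-mono : ∀ {H H′} → H ≼ H′ → [] ∈ H′ → [] ∈ H
[]∈-mono H≼ i with h , h∈ , s ← H≼ i with refl ← ⊆[]⇒≡[] s = h∈

mutual
  -- Staller plays on H as she would on H′: equal moves preserve `≼`, and every edge still unhit in
  -- H′ has an unhit edge of H inside it.
  holdS-mono : ∀ {k l H H′} → k ≤ l → H ≼ H′ → HoldS l H′ → HoldS k H
  holdS-mono k≤l H≼ ((_ , h∈) , u , D) with h , h∈ , _ ← H≼ h∈ =
    (h , h∈) , u , holdD-mono k≤l (⊖-mono u H≼) D

  holdD-mono : ∀ {k l H H′} → k ≤ l → H ≼ H′ → HoldD l H′ → HoldD k H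
  holdD-mono z≤n       H≼ D        = tt
  holdD-mono (s≤s k≤l) H≼ (inj₁ i) = inj₁ ([]∈-mono H≼ i)
  holdD-mono (s≤s k≤l) H≼ (inj₂ S) = inj₂ λ v → holdS-mono k≤l (∖-mono v H≼) (S v)

mutual
  canS-mono : ∀ {k l H H′} → k ≤ l → H ≼ H′ → CanS k H → CanS l H′
  canS-mono k≤l H≼ ([]∉ , S) = []∉ ∘ []∈-mono H≼ , reply S
    where
    reply : _ ⊎ _ → _
    reply (inj₂ S) = inj₂ λ u → canD-mono k≤l (⊖-mono u H≼) (S u)
    reply (inj₁ refl) = inj₁ (empty _ H≼)
      where
      empty : ∀ H′ → [] ≼ H′ → H′ ≡ []
      empty []       _ = refl
      empty (_ ∷ H′) p with () ← proj₁ (proj₂ (p (here refl)))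

  canD-mono : ∀ {k l H H′} → k ≤ l → H ≼ H′ → CanD k H → CanD l H′
  canD-mono (s≤s k≤l) H≼ (v , S) = v , canS-mono k≤l (∖-mono v H≼) S

-- Decidable strategies of Staller

Short : ℕ → Hypergraph → Set
Short m = Any λ h → length h ≤ m

short? : ∀ m H → Dec (Short m H)
short? m = any? λ h → length h ≤? m

-- HoldS k and HoldD (suc k), with both players confined to the support.
mutual
  Survives Survives′ : ℕ → Hypergraph → Set
  Survives zero    H = ∃ λ h → h ∈ H
  Survives (suc k) H = Any (λ u → Survives′ k (H ⊖ u)) (support H)

  Survives′ k H = Short 0 H ⊎ All (λ v → Survives k (H ∖ v)) (support H)

mutual
  survives? : ∀ k H → Dec (Survives k H)
  survives? zero    []      = no λ ()
  survives? zero    (h ∷ H) = yes (h , here refl)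
  survives? (suc k) H       = any? (λ u → survives′? k (H ⊖ u)) (support H)

  survives′? : ∀ k H → Dec (Survives′ k H)
  survives′? k H = short? 0 H ⊎-dec all? (λ v → survives? k (H ∖ v)) (support H)

short⇒[]∈ : ∀ {H} → Short 0 H → [] ∈ H
short⇒[]∈ = Any.map λ { {[]} z≤n → refl }

mutual
  survives⇒holdS : ∀ k {H} → Survives k H → HoldS k H
  -- No move of Dominator is left to survive, so Staller's move is arbitrary and `mid` is a filler.
  survives⇒holdS zero        p = p , mid , tt
  survives⇒holdS (suc k) {H} p with u , u∈ , q ← find p with h , _ , h∈ ← support⁻ H u∈ =
    (h , h∈) , u , survives′⇒holdD k (∈-⊖ u h∈) q

  -- A move of Dominator off the support hits nothing and serves him no better than hitting a label
  -- x of the given edge h, to which `Survives′` has an answer.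
  survives′⇒holdD : ∀ k {H h} → h ∈ H → Survives′ k H → HoldD (suc k) H
  survives′⇒holdD k h∈ (inj₁ s) = inj₁ (short⇒[]∈ s)
  survives′⇒holdD k {h = []} h∈ (inj₂ p) = inj₁ h∈
  survives′⇒holdD k {H} {x ∷ h} h∈ (inj₂ p) = inj₂ reply
    where
    reply : ∀ v → HoldS k (H ∖ v)
    reply v with v ∈? support H
    ... | yes v∈ = survives⇒holdS k (All.lookup p v∈)
    ... | no  v∉ = holdS-mono ℕ.≤-refl (≼-trans (≼-∖-∉ v∉) (≼-∖ x))
                     (survives⇒holdS k (All.lookup p (∈-support (here refl) h∈)))

-- Staller completes an edge even if Dominator may pass, so HoldS k follows for
-- every k; n bounds the depth of the search.
mutual
  Lost Lost′ : ℕ → Hypergraph → Set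
  Lost zero    H = Short 1 H
  Lost (suc n) H = Short 1 H ⊎ Any (λ u → Lost′ n (H ⊖ u)) (support H)

  Lost′ n H = Lost n H × All (λ v → Lost n (H ∖ v)) (support H)

mutual
  lost? : ∀ n H → Dec (Lost n H)
  lost? zero    H = short? 1 H
  lost? (suc n) H = short? 1 H ⊎-dec any? (λ u → lost′? n (H ⊖ u)) (support H)

  lost′? : ∀ n H → Dec (Lost′ n H)
  lost′? n H = lost? n H ×-dec all? (λ v → lost? n (H ∖ v)) (support H)

claimed : ∀ k {H} → [] ∈ H → HoldD k H
claimed zero    _  = tt
claimed (suc k) i = inj₁ i

opaque
  unfolding _without_

  claimable : ∀ h → length h ≤ 1 → ∃ λ u → h without u ≡ []
  claimable []           _       = mid , refl
  claimable (_ ∷ _ ∷ _) (s≤s ())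
  claimable (x ∷ [])     _       = x , lemma
    where
    lemma : (x ∷ []) without x ≡ []
    lemma with x ≟ x
    ... | yes _  = refl
    ... | no x≢x = contradiction refl x≢x

-- Relabelling along an injection

module _ (g : Label → Label) (g-injective : ∀ {x y} → g x ≡ g y → x ≡ y) where

  image : Hypergraph → Hypergraph
  image = map (map g)

  ∖-image : ∀ {H} v → image H ∖ g v ≼ image (H ∖ v)
  ∖-image v h∈ with h , h∈ , refl ← ∈-map⁻ (map g) h∈ with h∈ , v∉ ← ∈-∖⁻ h∈ =
    _ , ∈-∖ (∈-map⁺ (map g) h∈) gv∉ , id
    where
    gv∉ : g v ∉ map g h
    gv∉ gv∈ with y , y∈ , eq ← ∈-map⁻ g gv∈ with refl ← g-injective eq = v∉ y∈

  ⊖-image : ∀ {H} u → image H ⊖ g u ≼ image (H ⊖ u)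
  ⊖-image u h∈ with h , h∈ , refl ← ∈-map⁻ (map g) h∈ with h₀ , h₀∈ , refl ← ∈-⊖⁻ h∈ =
    _ , ∈-⊖ (g u) (∈-map⁺ (map g) h₀∈) , sub
    where
    sub : map g h₀ without g u ⊆ map g (h₀ without u)
    sub y∈ with x , x∈ , refl ← ∈-map⁻ g (without-⊆ y∈) =
      ∈-map⁺ g (∈-without x∈ λ { refl → ∉-without (map g h₀) y∈ })

  ∖-image-∉ : ∀ {H x} → x ∉ map g (support H) → image H ∖ x ≼ image H
  ∖-image-∉ {x = x} x∉ h∈ with h , h∈′ , refl ← ∈-map⁻ (map g) h∈ = _ , ∈-∖ h∈ x∉h , id
    where
    x∉h : x ∉ map g h
    x∉h x∈ with y , y∈ , refl ← ∈-map⁻ g x∈ = x∉ (∈-map⁺ g (∈-support y∈ h∈′))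

  holdS-short : ∀ k {H} → Short 1 H → HoldS k (image H)
  holdS-short k s with h , h∈ , h≤1 ← find s
                  with u , eq ← claimable (map g h) (subst (_≤ 1) (sym (length-map g h)) h≤1) =
    (_ , ∈-map⁺ (map g) h∈) , u , claimed k (subst (_∈ _) eq (∈-⊖ u (∈-map⁺ (map g) h∈)))

  mutual
    lost⇒holdS : ∀ n k {H} → Lost n H → HoldS k (image H)
    lost⇒holdS zero    k s            = holdS-short k s
    lost⇒holdS (suc n) k (inj₁ s)     = holdS-short k s
    lost⇒holdS (suc n) k {H} (inj₂ p) with u , u∈ , q ← find p with h , _ , h∈ ← support⁻ H u∈ =
      (_ , ∈-map⁺ (map g) h∈) , g u , holdD-mono ℕ.≤-refl (⊖-image u) (lost′⇒holdD n k q)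

    lost′⇒holdD : ∀ n k {H} → Lost′ n H → HoldD k (image H)
    lost′⇒holdD n zero        _       = tt
    lost′⇒holdD n (suc k) {H} (p , q) = inj₂ reply
      where
      reply : ∀ v → HoldS k (image H ∖ v)
      reply v with v ∈? map g (support H)
      -- A move off the image hits nothing in it and amounts to a pass, which the first half of
      -- `Lost′` permits.
      ... | no  v∉ = holdS-mono ℕ.≤-refl (∖-image-∉ v∉) (lost⇒holdS n k p)
      ... | yes v∈ with x , x∈ , refl ← ∈-map⁻ g v∈ =
        holdS-mono ℕ.≤-refl (∖-image x) (lost⇒holdS n k (All.lookup q x∈))

-- Play in a window of a larger hypergraph whose other edges R avoid the safe
-- labels. A reply of Dominator outside the window or at an unsafe label must
-- lose; otherwise R stays intact until Goal is reached, t counting the moves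
-- Dominator has spent.
module Sweep {Goal : ℕ → Hypergraph → Set} (goal? : ∀ t H → Dec (Goal t H))
             {Safe : Label → Set} (safe? : ∀ v → Dec (Safe v)) (d : ℕ) where

  mutual
    Swept Swept′ : ℕ → ℕ → Hypergraph → Set
    Swept zero    t H = Short 1 H ⊎ Goal t H
    Swept (suc n) t H = Short 1 H ⊎ Goal t H ⊎ Any (λ u → Swept′ n t (H ⊖ u)) (support H)

    Swept′ n t H = Lost d H × All (λ v → Safe v × Swept n (suc t) (H ∖ v) ⊎ Lost d (H ∖ v)) (support H)

  mutual
    swept? : ∀ n t H → Dec (Swept n t H)
    swept? zero    t H = short? 1 H ⊎-dec goal? t H
    swept? (suc n) t H = short? 1 H ⊎-dec goal? t H ⊎-dec any? (λ u → swept′? n t (H ⊖ u)) (support H)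

    swept′? : ∀ n t H → Dec (Swept′ n t H)
    swept′? n t H =
      lost? d H ×-dec all? (λ v → (safe? v ×-dec swept? n (suc t) (H ∖ v)) ⊎-dec lost? d (H ∖ v)) (support H)

  module Sound (g : Label → Label) (g-injective : ∀ {x y} → g x ≡ g y → x ≡ y)
               {K : ℕ} {R : Hypergraph}
               (safe : ∀ {v h} → Safe v → h ∈ R → g v ∉ h)
               (goal : ∀ {t k H} → Goal t H → t + k ≡ K → HoldS k (image g g-injective H ++ R))
    where

    private
      img = image g g-injective
      ++-≼ˡ : ∀ {H} → H ++ R ≼ H
      ++-≼ˡ = ≼-⊇ ∈-++⁺ˡ

      ∖-++ : ∀ {H v} → Safe v → (img H ++ R) ∖ g v ≼ img (H ∖ v) ++ R
      ∖-++ {H} {v} sv h∈ with ∈-++⁻ (img (H ∖ v)) h∈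
      ... | inj₁ h∈ with h , i , s ← ∖-image g g-injective v h∈ with j , gv∉ ← ∈-∖⁻ i =
        h , ∈-∖ (∈-++⁺ˡ j) gv∉ , s
      ... | inj₂ h∈ = _ , ∈-∖ (∈-++⁺ʳ (img H) h∈) (safe sv h∈) , id

      -- Staller's move may also shrink edges of R. This only favours her, so R can be kept whole in
      -- the comparison.
      ⊖-++ : ∀ {H} u → (img H ++ R) ⊖ g u ≼ img (H ⊖ u) ++ R
      ⊖-++ {H} u h∈ with ∈-++⁻ (img (H ⊖ u)) h∈
      ... | inj₁ h∈ with h , i , s ← ⊖-image g g-injective u h∈ with h₀ , j , refl ← ∈-⊖⁻ i =
        _ , ∈-⊖ (g u) (∈-++⁺ˡ j) , s
      ... | inj₂ h∈ = _ , ∈-⊖ (g u) (∈-++⁺ʳ (img H) h∈) , without-⊆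

    mutual
      swept⇒holdS : ∀ n {t k H} → Swept n t H → t + k ≡ K → HoldS k (img H ++ R)
      swept⇒holdS zero    (inj₁ s) _ = holdS-mono ℕ.≤-refl ++-≼ˡ (holdS-short g g-injective _ s)
      swept⇒holdS zero    (inj₂ p) e = goal p e
      swept⇒holdS (suc n) (inj₁ s) _ = holdS-mono ℕ.≤-refl ++-≼ˡ (holdS-short g g-injective _ s)
      swept⇒holdS (suc n) (inj₂ (inj₁ p)) e = goal p e
      swept⇒holdS (suc n) {H = H} (inj₂ (inj₂ p)) e with u , u∈ , q ← find p =
        opening⇒holdS n u u∈ q e

      opening⇒holdS : ∀ n {t k H} u → u ∈ support H → Swept′ n t (H ⊖ u) → t + k ≡ K → HoldS k (img H ++ R)
      opening⇒holdS n {H = H} u u∈ q e with h , _ , h∈ ← support⁻ H u∈ =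
        (_ , ∈-++⁺ˡ (∈-map⁺ (map g) h∈)) , g u ,
        holdD-mono ℕ.≤-refl (⊖-++ u) (swept′⇒holdD n q e)

      swept′⇒holdD : ∀ n {t k H} → Swept′ n t H → t + k ≡ K → HoldD k (img H ++ R)
      swept′⇒holdD n {k = zero}  _ _ = tt
      swept′⇒holdD n {t} {suc k} {H} (p , q) e = inj₂ reply
        where
        ∖-≼ˡ : ∀ v → (img H ++ R) ∖ v ≼ img H ∖ v
        ∖-≼ˡ v = ∖-mono v ++-≼ˡ

        reply : ∀ v → HoldS k ((img H ++ R) ∖ v)
        reply v with v ∈? map g (support H)
        ... | no  v∉ = holdS-mono ℕ.≤-refl (≼-trans (∖-≼ˡ v) (∖-image-∉ g g-injective v∉))
                         (lost⇒holdS g g-injective d k p)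
        ... | yes v∈ with x , x∈ , refl ← ∈-map⁻ g v∈ with All.lookup q x∈
        ...   | inj₁ (sx , s) = holdS-mono ℕ.≤-refl (∖-++ sx)
                                  (swept⇒holdS n s (trans (sym (ℕ.+-suc t k)) e))
        -- An unsafe move may have hit edges of R as well, but `Lost` concerns the window alone, so
        -- R is dropped.
        ...   | inj₂ l = holdS-mono ℕ.≤-refl (≼-trans (∖-≼ˡ v) (∖-image g g-injective x))
                           (lost⇒holdS g g-injective d k l)

-- The two sides of Dominator's first column

-- Closed neighbourhoods of `at s d r`; `end` is the one in the last column, where the outward
-- neighbour is missing. At distance 0 the inward neighbour is `mid` only for row `true`, and
-- neither `rows` nor `endRows` lists the other row there.
edge end : Bool → ℕ → Bool → Edge
edge s zero    r = at s 0 r ∷ at s 0 (not r) ∷ at s 1 r ∷ mid ∷ []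
edge s (suc d) r = at s (suc d) r ∷ at s (suc d) (not r) ∷ at s (suc (suc d)) r ∷ at s d r ∷ []

end s zero    r = at s 0 r ∷ at s 0 (not r) ∷ mid ∷ []
end s (suc d) r = at s (suc d) r ∷ at s (suc d) (not r) ∷ at s d r ∷ []

-- Dominator's first vertex already dominates the neighbours `at s 0 false`.
rows : ℕ → List Bool
rows zero    = true ∷ []
rows (suc _) = false ∷ true ∷ []

-- `cut r`: all columns further out are settled, and in the outermost column only
-- the neighbourhood of the vertex in row r is still to be hit.
data End : Set where
  fresh : End
  cut   : (row : Bool) → End

endRows : End → ℕ → List Bool
endRows fresh       d       = rows d
endRows (cut true)  _       = true ∷ []
endRows (cut false) zero    = []
endRows (cut false) (suc _) = false ∷ []

-- Edges at the distances b, …, b + l - 1, and likewise for `side`.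
edges : Bool → ℕ → ℕ → Hypergraph
edges s b zero    = []
edges s b (suc l) = map (edge s (b + l)) (rows (b + l)) ++ edges s b l

side : Bool → End → ℕ → ℕ → Hypergraph
side s e b zero    = []
side s e b (suc l) = map (end s (b + l)) (endRows e (b + l)) ++ edges s b l

-- A form of `H ≼ G` that can be decided.
Covers : Hypergraph → Hypergraph → Set
Covers H G = All (λ g → Any (λ h → All (_∈ g) h) H) G

covers? : ∀ H G → Dec (Covers H G)
covers? H = all? λ g → any? (λ h → all? (_∈? g) h) H

-- The window had suc n columns; each of those removed has cost Dominator a move.
Goal : ℕ → ℕ → ℕ → Hypergraph → Set
Goal b n t H = Any (λ l → suc n ≤ suc l + t × Any (λ r → Covers H (side true (cut r) b (suc l)))
                 (false ∷ true ∷ [])) (downFrom n)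

goal? : ∀ b n t H → Dec (Goal b n t H)
goal? b n t H = any? (λ l → suc n ≤? suc l + t ×-dec any? (λ r → covers? H (side true (cut r) b (suc l)))
                  (false ∷ true ∷ [])) (downFrom n)

-- With b = 1, the edges at distance 0 lie outside the window and contain labels
-- at distances 0 and 1. With b = 0 the window is a whole side up to `mid`.
data Inner (b : ℕ) : Label → Set where
  inner : ∀ {d r} → b + b ≤ d → Inner b (at true d r)

inner? : ∀ b v → Dec (Inner b v)
inner? b mid            = no λ ()
inner? b (at false d r) = no λ ()
inner? b (at true d r)  = map′ inner (λ { (inner p) → p }) (b + b ≤? d)

module Descent (b n depth : ℕ) where

  open Sweep (goal? b n) (inner? b) depth public

  record Opening (e : End) (u : Label) (i : ℕ) : Set where
    constructor opening
    field
      legal : u ∈ support (side true e b (suc n))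
      swept : Swept′ i 0 (side true e b (suc n) ⊖ u)

  opening? : ∀ e u i → Dec (Opening e u i)
  opening? e u i = map′ (λ (p , q) → opening p q) (λ (opening p q) → p , q)
                     (u ∈? _ ×-dec swept′? i 0 _)

open Descent using (Opening; opening?)

opaque
  unfolding _∖_ _⊖_ _without_ support

  -- Staller takes a corner. If Dominator takes the other one, then of the next column only the
  -- neighbourhood beside the claimed corner remains, which is `cut false`. The search settles all
  -- other replies.
  fresh₃ : Opening 0 2 2 fresh (at true 2 false) 2
  fresh₃ = from-yes (opening? 0 2 2 fresh (at true 2 false) 2)

  fresh₄ : Opening 0 3 2 fresh (at true 3 false) 2
  fresh₄ = from-yes (opening? 0 3 2 fresh (at true 3 false) 2)

  fresh₅ : Opening 0 4 2 fresh (at true 4 false) 2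
  fresh₅ = from-yes (opening? 0 4 2 fresh (at true 4 false) 2)

  -- Starting at distance 1, these five columns do not involve `mid`, so the window can be moved
  -- outwards by any amount.
  fresh₆ : Opening 1 4 2 fresh (at true 5 false) 2
  fresh₆ = from-yes (opening? 1 4 2 fresh (at true 5 false) 2)

  -- Staller plays in the last column but one, in row r, so that the remaining outermost
  -- neighbourhood can be hit only in the last column.
  cut₄ : ∀ r → Opening 0 3 3 (cut r) (at true 2 r) 3
  cut₄ false = from-yes (opening? 0 3 3 (cut false) (at true 2 false) 3)
  cut₄ true  = from-yes (opening? 0 3 3 (cut true) (at true 2 true) 3)

  cut₅ : ∀ r → Opening 0 4 3 (cut r) (at true 3 r) 3
  cut₅ false = from-yes (opening? 0 4 3 (cut false) (at true 3 false) 3)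
  cut₅ true  = from-yes (opening? 0 4 3 (cut true) (at true 3 true) 3)

  cut₆ : ∀ r → Opening 1 4 3 (cut r) (at true 4 r) 3
  cut₆ false = from-yes (opening? 1 4 3 (cut false) (at true 4 false) 3)
  cut₆ true  = from-yes (opening? 1 4 3 (cut true) (at true 4 true) 3)

-- The sides that are too short for any of these openings.
smallSides : List (End × ℕ)
smallSides = (fresh , 0) ∷ (fresh , 1) ∷ (fresh , 2) ∷ (cut false , 0) ∷ (cut true , 0) ∷
             (cut false , 1) ∷ (cut true , 1) ∷ (cut false , 2) ∷ (cut true , 2) ∷
             (cut false , 3) ∷ (cut true , 3) ∷ []

opaque
  unfolding _∖_ _⊖_ _without_ support

  -- With the opening vertex and one more move than is survived, Dominator needs at least m + n - 1
  -- moves on m + n + 1 columns: this is where the saving of two is fixed.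
  smallSides-survive :
    All (λ (a , m) → All (λ (b , n) →
      m + n < 3 ⊎ Survives (m + n ∸ 3) (side true a 0 m ++ side false b 0 n)) smallSides) smallSides
  smallSides-survive = from-yes (all? (λ (a , m) → all? (λ (b , n) →
      m + n <? 3 ⊎-dec survives? (m + n ∸ 3) (side true a 0 m ++ side false b 0 n)) smallSides) smallSides)

-- `embed s f` moves the side true, on which windows are searched, to the side s.
twist : Bool → Bool → Bool
twist s true  = s
twist s false = not s

twist-injective : ∀ s {x y} → twist s x ≡ twist s y → x ≡ y
twist-injective s     {true}  {true}  _ = refl
twist-injective s     {false} {false} _ = refl
twist-injective true  {true}  {false} ()
twist-injective true  {false} {true}  ()
twist-injective false {true}  {false} ()
twist-injective false {false} {true}  ()

embed : Bool → (ℕ → ℕ) → Label → Label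
embed s f mid         = mid
embed s f (at t d r)  = at (twist s t) (f d) r

at-injective : ∀ {s d r s′ d′ r′} → at s d r ≡ at s′ d′ r′ → s ≡ s′ × d ≡ d′ × r ≡ r′
at-injective refl = refl , refl , refl

embed-injective : ∀ s {f} → (∀ {d d′} → f d ≡ f d′ → d ≡ d′) → ∀ {x y} → embed s f x ≡ embed s f y → x ≡ y
embed-injective s f-inj {mid}      {mid}      _ = refl
embed-injective s f-inj {at t d r} {at t′ d′ r′} e with p , q , r≡r′ ← at-injective e =
  cong₃ (twist-injective s {t} {t′} p) (f-inj q) r≡r′
  where
  cong₃ : ∀ {s d r s′ d′ r′} → s ≡ s′ → d ≡ d′ → r ≡ r′ → at s d r ≡ at s′ d′ r′
  cong₃ refl refl refl = refl

module _ (s : Bool) where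

  edge-id : ∀ d r → map (embed s id) (edge true d r) ≡ edge s d r
  edge-id zero    r = refl
  edge-id (suc d) r = refl

  end-id : ∀ d r → map (embed s id) (end true d r) ≡ end s d r
  end-id zero    r = refl
  end-id (suc d) r = refl

  map-map : ∀ {f : Label → Label} {p q : ℕ → Bool → Edge} {d d′} → (∀ r → map f (p d r) ≡ q d′ r) →
            ∀ rs → map (map f) (map (p d) rs) ≡ map (q d′) rs
  map-map eq []       = refl
  map-map {p = p} {q} eq (r ∷ rs) = cong₂ _∷_ (eq r) (map-map {p = p} {q} eq rs)

  edges-id : ∀ l → map (map (embed s id)) (edges true 0 l) ≡ edges s 0 l
  edges-id zero    = refl
  edges-id (suc l) = trans (map-++ _ (map (edge true l) (rows l)) _)
                       (cong₂ _++_ (map-map {p = edge true} {q = edge s} (edge-id l) (rows l)) (edges-id l))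

  side-id : ∀ e l → map (map (embed s id)) (side true e 0 l) ≡ side s e 0 l
  side-id e zero    = refl
  side-id e (suc l) = trans (map-++ _ (map (end true l) (endRows e l)) _)
                       (cong₂ _++_ (map-map {p = end true} {q = end s} (end-id l) (endRows e l)) (edges-id l))

  module _ (j : ℕ) where

    edges-shift : ∀ l → map (map (embed s (_+ j))) (edges true 1 l) ++ edges s 0 (suc j) ≡
                        edges s 0 (suc (l + j))
    edges-shift zero    = refl
    edges-shift (suc l) = cong (λ E → edge s (suc (l + j)) false ∷ edge s (suc (l + j)) true ∷ E) (edges-shift l)

    side-shift : ∀ e l → map (map (embed s (_+ j))) (side true e 1 (suc l)) ++ edges s 0 (suc j) ≡
                         side s e 0 (suc (suc (l + j)))
    side-shift fresh       l = cong (λ E → end s (suc (l + j)) false ∷ end s (suc (l + j)) true ∷ E) (edges-shift l)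
    side-shift (cut false) l = cong (end s (suc (l + j)) false ∷_) (edges-shift l)
    side-shift (cut true)  l = cong (end s (suc (l + j)) true ∷_) (edges-shift l)

edge-bound : ∀ {s t x q} d {r} → at t x q ∈ edge s d r → t ≡ s × x ≤ suc d
edge-bound zero    (here refl)                         = refl , z≤n
edge-bound zero    (there (here refl))                 = refl , z≤n
edge-bound zero    (there (there (here refl)))         = refl , ℕ.≤-refl
edge-bound zero    (there (there (there (here ()))))
edge-bound (suc d) (here refl)                         = refl , ℕ.n≤1+n _
edge-bound (suc d) (there (here refl))                 = refl , ℕ.n≤1+n _
edge-bound (suc d) (there (there (here refl)))         = refl , ℕ.≤-refl
edge-bound (suc d) (there (there (there (here refl)))) = refl , ℕ.≤-trans (ℕ.n≤1+n d) (ℕ.n≤1+n _)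

end⊆edge : ∀ {s x} d {r} → x ∈ end s d r → x ∈ edge s d r
end⊆edge zero    (here p)                  = here p
end⊆edge zero    (there (here p))          = there (here p)
end⊆edge zero    (there (there (here p)))  = there (there (there (here p)))
end⊆edge (suc d) (here p)                  = here p
end⊆edge (suc d) (there (here p))          = there (here p)
end⊆edge (suc d) (there (there (here p)))  = there (there (there (here p)))

edges-bound : ∀ {s t x q h} l → h ∈ edges s 0 l → at t x q ∈ h → t ≡ s × x ≤ l
edges-bound {s} (suc l) h∈ x∈ with ∈-++⁻ (map (edge s l) (rows l)) h∈
... | inj₂ h∈ with t≡s , x≤ ← edges-bound l h∈ x∈ = t≡s , ℕ.m≤n⇒m≤1+n x≤
... | inj₁ h∈ with _ , _ , refl ← ∈-map⁻ (edge s l) h∈ = edge-bound l x∈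

side-bound : ∀ {s t x q h} e l → h ∈ side s e 0 l → at t x q ∈ h → t ≡ s × x ≤ l
side-bound {s} e (suc l) h∈ x∈ with ∈-++⁻ (map (end s l) (endRows e l)) h∈
... | inj₂ h∈ with t≡s , x≤ ← edges-bound l h∈ x∈ = t≡s , ℕ.m≤n⇒m≤1+n x≤
... | inj₁ h∈ with _ , _ , refl ← ∈-map⁻ (end s l) h∈ = edge-bound l (end⊆edge l x∈)

covers⇒≼ : ∀ {f : Label → Label} {H G} → Covers H G → map (map f) H ≼ map (map f) G
covers⇒≼ {f} {H} {G} c h∈ with g , g∈ , refl ← ∈-map⁻ (map f) h∈ with h , h∈ , h⊆ ← find (All.lookup c g∈) =
  map f h , ∈-map⁺ (map f) h∈ , λ y∈ → sub (∈-map⁻ f y∈)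
  where
  sub : ∀ {y} → ∃ (λ x → x ∈ h × y ≡ f x) → y ∈ map f g
  sub (x , x∈ , refl) = ∈-map⁺ f (All.lookup h⊆ x∈)

-- Written in continuation form, because the number of columns swept off depends on Dominator's
-- replies. By `m ≤ l + t` each of them has cost him a move. R stands for the other side, which may
-- share `mid` but no further label.
Reducible : End → ℕ → Set
Reducible e m = ∀ s {K R} → (∀ {h d r} → h ∈ R → at s d r ∉ h) →
  (∀ {l r t k} → l < m → m ≤ l + t → t + k ≡ K → HoldS k (side s (cut r) 0 l ++ R)) →
  HoldS K (side s e 0 m ++ R)

module _ {b n depth e u i} (o : Opening b n depth e u i) (s : Bool) (f : ℕ → ℕ)
         (f-injective : ∀ {d d′} → f d ≡ f d′ → d ≡ d′) (j : ℕ) (E : Hypergraph)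
         (tail : ∀ e l → map (map (embed s f)) (side true e b (suc l)) ++ E ≡ side s e 0 (j + suc l))
         (safe : ∀ {h d r} → b + b ≤ d → h ∈ E → at s (f d) r ∉ h) where

  -- The sweep runs with E ++ R as its untouched rest: safe labels miss E by distance and R by side.
  -- Once the goal is reached, the covered window is glued to E again and forms a shorter `cut`
  -- side.
  opening⇒reducible : ∀ {K R} → (∀ {h d r} → h ∈ R → at s d r ∉ h) →
    (∀ {l r t k} → l < j + suc n → j + suc n ≤ l + t → t + k ≡ K → HoldS k (side s (cut r) 0 l ++ R)) →
    HoldS K (side s e 0 (j + suc n) ++ R)
  opening⇒reducible {K} {R} avoids hold =
    subst (HoldS K) (trans (sym (++-assoc _ E R)) (cong (_++ R) (tail e n)))
      (opening⇒holdS i u (Descent.Opening.legal o) (Descent.Opening.swept o) refl)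
    where
    safe′ : ∀ {v h} → Inner b v → h ∈ E ++ R → embed s f v ∉ h
    safe′ (inner p) h∈ with ∈-++⁻ E h∈
    ... | inj₁ h∈ = safe p h∈
    ... | inj₂ h∈ = avoids h∈

    goal : ∀ {t k H} → Goal b n t H → t + k ≡ K → HoldS k (map (map (embed s f)) H ++ E ++ R)
    goal {t} {k} {H} p eq with l , l∈ , n≤ , q ← find p with r , _ , c ← find q =
      holdS-mono ℕ.≤-refl
        (++-mono {map (map (embed s f)) H} {map (map (embed s f)) (side true (cut r) b (suc l))}
          (covers⇒≼ c) (≼-refl {E ++ R}))
        (subst (HoldS k) (trans (cong (_++ R) (sym (tail (cut r) l))) (++-assoc _ E R))
          (hold (ℕ.+-monoʳ-< j (s≤s (∈-downFrom⁻ l∈)))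
                (ℕ.≤-trans (ℕ.+-monoʳ-≤ j n≤) (ℕ.≤-reflexive (sym (ℕ.+-assoc j (suc l) t)))) eq))

    open Descent b n depth
    open Sound (embed s f) (embed-injective s f-injective) safe′ goal

near : ∀ {n depth e u i} → Opening 0 n depth e u i → Reducible e (suc n)
near o s = opening⇒reducible o s id id 0 []
             (λ e l → trans (++-identityʳ _) (side-id s e (suc l))) (λ _ ())

far : ∀ {n depth e u i} → Opening 1 n depth e u i → ∀ j → Reducible e (suc j + suc n)
far o j s = opening⇒reducible o s (_+ j) (ℕ.+-cancelʳ-≡ j _ _) (suc j) (edges s 0 (suc j))
              (λ e l → trans (side-shift s j e l) (cong (λ m → side s e 0 (suc m)) (ℕ.+-comm (suc l) j)))
              -- Safe labels are moved to distance at least 2 + j, while the inner columns only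
              -- reach labels up to distance 1 + j.
              (λ 2≤d h∈ x∈ → ℕ.<-irrefl refl
                 (ℕ.≤-trans (ℕ.+-monoˡ-≤ j 2≤d) (proj₂ (edges-bound (suc j) h∈ x∈))))

far′ : ∀ {n depth e u i} → Opening 1 n depth e u i → ∀ j → Reducible e (2 + n + j)
far′ {n} {e = e} o j = subst (Reducible e) (cong suc (ℕ.+-comm j (suc n))) (far o j)

-- Up to five columns the window is the whole side; from six columns on it consists of the five
-- outermost ones.
small⊎reducible : ∀ e m → (e , m) ∈ smallSides ⊎ Reducible e m
small⊎reducible fresh 0 = inj₁ (here refl)
small⊎reducible fresh 1 = inj₁ (there (here refl))
small⊎reducible fresh 2 = inj₁ (there (there (here refl)))
small⊎reducible fresh 3 = inj₂ (near fresh₃)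
small⊎reducible fresh 4 = inj₂ (near fresh₄)
small⊎reducible fresh 5 = inj₂ (near fresh₅)
small⊎reducible fresh (suc (suc (suc (suc (suc (suc j)))))) = inj₂ (far′ fresh₆ j)
small⊎reducible (cut false) 0 = inj₁ (there (there (there (here refl))))
small⊎reducible (cut true)  0 = inj₁ (there (there (there (there (here refl)))))
small⊎reducible (cut false) 1 = inj₁ (there (there (there (there (there (here refl))))))
small⊎reducible (cut true)  1 = inj₁ (there (there (there (there (there (there (here refl)))))))
small⊎reducible (cut false) 2 = inj₁ (there (there (there (there (there (there (there (here refl))))))))
small⊎reducible (cut true)  2 = inj₁ (there (there (there (there (there (there (there (there (here refl)))))))))
small⊎reducible (cut false) 3 = inj₁ (there (there (there (there (there (there (there (there (there (here refl))))))))))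
small⊎reducible (cut true)  3 = inj₁ (there (there (there (there (there (there (there (there (there (there (here refl)))))))))))
small⊎reducible (cut r) 4 = inj₂ (near (cut₄ r))
small⊎reducible (cut r) 5 = inj₂ (near (cut₅ r))
small⊎reducible (cut r) (suc (suc (suc (suc (suc (suc j)))))) = inj₂ (far′ (cut₆ r) j)

-- The lower bound for two sides

Held : ℕ → End → ℕ → End → ℕ → Set
Held k a m b n = ∀ {s t} → s ≢ t → HoldS k (side s a 0 m ++ side t b 0 n)

held-swap : ∀ {k} a m b n → Held k b n a m → Held k a m b n
held-swap a m b n p {s} {t} s≢t =
  holdS-mono ℕ.≤-refl (++-comm-≼ (side s a 0 m) (side t b 0 n)) (p (s≢t ∘ sym))

held-small : ∀ {k a m b n} → k + 3 ≤ m + n → (a , m) ∈ smallSides → (b , n) ∈ smallSides → Held k a m b n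
held-small {k} {a} {m} {b} {n} k+3≤ a∈ b∈ {s} {t} = go s t
  where
  go : ∀ s t → s ≢ t → HoldS k (side s a 0 m ++ side t b 0 n)
  right : ∀ {a m b n} → k + 3 ≤ m + n → (a , m) ∈ smallSides → (b , n) ∈ smallSides →
          HoldS k (side true a 0 m ++ side false b 0 n)
  right {a} {m} {b} {n} k+3≤ a∈ b∈ with All.lookup (All.lookup smallSides-survive a∈) b∈
  ... | inj₁ m+n<3 = contradiction (ℕ.≤-trans (ℕ.m≤n+m 3 k) k+3≤) (ℕ.<⇒≱ m+n<3)
  ... | inj₂ sv    = holdS-mono (subst (_≤ m + n ∸ 3) (ℕ.m+n∸n≡m k 3) (ℕ.∸-monoˡ-≤ 3 k+3≤)) ≼-refl
                       (survives⇒holdS (m + n ∸ 3) sv)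

  go true  true  s≢t = contradiction refl s≢t
  go true  false s≢t = right k+3≤ a∈ b∈
  go false true  s≢t = holdS-mono ℕ.≤-refl (++-comm-≼ (side false a 0 m) (side true b 0 n))
                         (right (subst (k + 3 ≤_) (ℕ.+-comm m n) k+3≤) b∈ a∈)
  go false false s≢t = contradiction refl s≢t

-- Induction on the total number of columns, bounded by N. Reducing a side removes at most as many
-- columns as Dominator spends moves, so `k + 3 ≤ m + n` persists until both sides are small and the
-- search applies.
held : ∀ N {k} a m b n → m + n ≤ N → k + 3 ≤ m + n → Held k a m b n
held zero {k} a m b n ≤0 k+3≤ = contradiction (ℕ.≤-trans (ℕ.m≤n+m 3 k) (ℕ.≤-trans k+3≤ ≤0)) λ ()
held (suc N) {k} a m b n ≤N k+3≤ = go (small⊎reducible a m) (small⊎reducible b n)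
  where
  reduce : ∀ {a m b n} → m + n ≤ suc N → k + 3 ≤ m + n → Reducible a m → Held k a m b n
  reduce {a} {m} {b} {n} ≤N k+3≤ red {s} {t} s≢t =
    red s (λ h∈ x∈ → s≢t (proj₁ (side-bound b n h∈ x∈))) λ {l} {r} {i} {k′} l<m m≤ eq →
      held N (cut r) l b n (s≤s⁻¹ (ℕ.≤-trans (ℕ.+-monoˡ-≤ n l<m) ≤N)) (budget l i k′ m≤ eq) s≢t
    where
    budget : ∀ l i k′ → m ≤ l + i → i + k′ ≡ k → k′ + 3 ≤ l + n
    budget l i k′ m≤ refl = ℕ.+-cancelˡ-≤ i _ _ (begin
      i + (k′ + 3) ≡⟨ ℕ.+-assoc i k′ 3 ⟨
      i + k′ + 3   ≤⟨ k+3≤ ⟩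
      m + n        ≤⟨ ℕ.+-monoˡ-≤ n m≤ ⟩
      l + i + n    ≡⟨ cong (_+ n) (ℕ.+-comm l i) ⟩
      i + l + n    ≡⟨ ℕ.+-assoc i l n ⟩
      i + (l + n)  ∎)
      where open ℕ.≤-Reasoning

  go : _ ⊎ _ → _ ⊎ _ → Held k a m b n
  go (inj₂ r)  _         = reduce {a} {m} {b} {n} ≤N k+3≤ r
  go (inj₁ _)  (inj₂ r)  = held-swap a m b n (reduce {b} {n} {a} {m} (subst (_≤ suc N) (ℕ.+-comm m n) ≤N) (subst (k + 3 ≤_) (ℕ.+-comm m n) k+3≤) r)
  go (inj₁ a∈) (inj₁ b∈) = held-small {k} {a} {m} {b} {n} k+3≤ a∈ b∈

-- Dominator's strategies

-- A move of Staller off the support changes no edge, so Dominator may answer as if she had claimed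
-- a label x of the first edge.
canS-intro : ∀ {k H} → [] ∉ H → (∀ {u} → u ∈ support H → CanD k (H ⊖ u)) → CanS k H
canS-intro {H = []}          []∉ _ = []∉ , inj₁ refl
canS-intro {H = [] ∷ H}      []∉ _ = contradiction (here refl) []∉
canS-intro {k} {H = (x ∷ h) ∷ H} []∉ D = []∉ , inj₂ reply
  where
  reply : ∀ u → CanD k (((x ∷ h) ∷ H) ⊖ u)
  reply u with u ∈? support ((x ∷ h) ∷ H)
  ... | yes u∈ = D u∈
  ... | no  u∉ = canD-mono ℕ.≤-refl (≼-trans (⊖-≼ x) (⊖-∉-≼ u∉)) (D (∈-support (here refl) (here refl)))

Disjoint : Hypergraph → Hypergraph → Set
Disjoint H₁ H₂ = ∀ {x h₁ h₂} → h₁ ∈ H₁ → h₂ ∈ H₂ → x ∈ h₁ → x ∉ h₂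

⊖∖-disjoint : ∀ {H₁ H₂} u v → Disjoint H₁ H₂ → Disjoint (H₁ ⊖ u ∖ v) H₂
⊖∖-disjoint u v dis h₁∈ h₂∈ x∈ with h₁∈ , _ ← ∈-∖⁻ h₁∈ with h , h∈ , refl ← ∈-⊖⁻ h₁∈ = dis h∈ h₂∈ (without-⊆ x∈)

⊖∖-++ : ∀ {H₁ H₂ u} v → u ∉ support H₂ → (H₁ ⊖ u ∖ v) ++ H₂ ≼ (H₁ ++ H₂) ⊖ u ∖ v
⊖∖-++ {H₁} {H₂} {u} v u∉ h∈ with h∈ , v∉ ← ∈-∖⁻ h∈ with h , h∈ , refl ← ∈-⊖⁻ h∈ with ∈-++⁻ H₁ h∈
... | inj₁ i = _ , ∈-++⁺ˡ (∈-∖ (∈-⊖ u i) v∉) , id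
... | inj₂ i = h , ∈-++⁺ʳ (H₁ ⊖ u ∖ v) i , λ x∈ → ∈-without x∈ λ { refl → u∉ (∈-support x∈ i) }

mutual
  -- Dominator answers in the part where Staller has just played, and the numbers of moves add up. A
  -- move in neither part is treated as one in the second.
  canS-++ : ∀ a b {H₁ H₂} → Disjoint H₁ H₂ → CanS a H₁ → CanS b H₂ → CanS (a + b) (H₁ ++ H₂)
  canS-++ a b dis (_ , inj₁ refl) C₂ = canS-mono (ℕ.m≤n+m b a) ≼-refl C₂
  canS-++ a b {H₁} dis C₁@(_ , inj₂ _) (_ , inj₁ refl) =
    canS-mono (ℕ.m≤m+n a b) (≼-⊇ (subst (_ ∈_) (++-identityʳ H₁))) C₁
  canS-++ a b {H₁} {H₂} dis C₁@(∉₁ , inj₂ D₁) C₂@(∉₂ , inj₂ D₂) =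
    canS-intro (λ i → [ ∉₁ , ∉₂ ] (∈-++⁻ H₁ i)) λ {u} _ → reply u
    where
    reply : ∀ u → CanD (a + b) ((H₁ ++ H₂) ⊖ u)
    reply u with u ∈? support H₁
    ... | no  u∉ = canD-mono (ℕ.≤-reflexive (ℕ.+-comm b a)) (⊖-mono u (++-comm-≼ H₂ H₁))
                     (canD-++ b a u u∉ (λ p q x∈ y∈ → dis q p y∈ x∈) (D₂ u) C₁)
    ... | yes u∈ = canD-++ a b u u∉ dis (D₁ u) C₂
      where
      u∉ : u ∉ support H₂
      u∉ u∈₂ with h₁ , x₁ , i₁ ← support⁻ H₁ u∈ with h₂ , x₂ , i₂ ← support⁻ H₂ u∈₂ = dis i₁ i₂ x₁ x₂

  canD-++ : ∀ a b {H₁ H₂} u → u ∉ support H₂ → Disjoint H₁ H₂ →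
            CanD a (H₁ ⊖ u) → CanS b H₂ → CanD (a + b) ((H₁ ++ H₂) ⊖ u)
  canD-++ (suc a) b u u∉ dis (v , C₁) C₂ =
    v , canS-mono ℕ.≤-refl (⊖∖-++ v u∉) (canS-++ a b (⊖∖-disjoint u v dis) C₁ C₂)

canS-empty : ∀ {k H} → (∀ {h} → h ∉ H) → CanS k H
canS-empty {H = []}    _ = (λ ()) , inj₁ refl
canS-empty {H = h ∷ H} p = contradiction (here refl) p

canS-edge : ∀ {x y} → x ≢ y → CanS 1 ((x ∷ y ∷ []) ∷ [])
canS-edge {x} {y} x≢y = (λ { (here ()) ; (there ()) }) , inj₂ reply
  where
  hit : ∀ {u v} → v ∈ x ∷ y ∷ [] → v ≢ u → CanS 0 (((x ∷ y ∷ []) ∷ []) ⊖ u ∖ v)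
  hit {u} {v} v∈ v≢u = canS-empty empty
    where
    empty : ∀ {h} → h ∉ ((x ∷ y ∷ []) ∷ []) ⊖ u ∖ v
    empty h∈ with h∈ , v∉ ← ∈-∖⁻ h∈ with ∈-⊖⁻ h∈
    ... | _ , here refl , refl = v∉ (∈-without v∈ v≢u)

  reply : ∀ u → CanD 1 (((x ∷ y ∷ []) ∷ []) ⊖ u)
  reply u with x ≟ u
  ... | yes refl = y , hit (there (here refl)) (x≢y ∘ sym)
  ... | no  x≢u  = x , hit (here refl) x≢u

-- What the pair (x , y) leaves of H when Dominator answers each of x and y by the
-- other one.
_⊘_ : Hypergraph → Label × Label → Hypergraph
H ⊘ (x , y) = filter (λ h → ¬? (x ∈? h ×-dec y ∈? h)) H ⊖ x ⊖ y

-- The pair acts as a separate two-element edge, worth one move. It lies inside every edge that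
-- contains both x and y, and all other edges can do without these two labels.
canS-pair : ∀ {k H x y} → x ≢ y → CanS k (H ⊘ (x , y)) → CanS (suc k) H
canS-pair {k} {H} {x} {y} x≢y C = canS-mono ℕ.≤-refl refine (canS-++ 1 k disjoint (canS-edge x≢y) C)
  where
  disjoint : Disjoint ((x ∷ y ∷ []) ∷ []) (H ⊘ (x , y))
  disjoint (here refl) h∈ z∈ z∈h with h , h∈ , refl ← ∈-⊖⁻ h∈ with h₀ , _ , refl ← ∈-⊖⁻ h∈ with z∈
  ... | here refl         = ∉-without h₀ (without-⊆ z∈h)
  ... | there (here refl) = ∉-without h z∈h

  refine : ((x ∷ y ∷ []) ∷ []) ++ (H ⊘ (x , y)) ≼ H
  refine {h} h∈ with x ∈? h ×-dec y ∈? h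
  ... | yes (x∈ , y∈) = _ , here refl , λ { (here refl) → x∈ ; (there (here refl)) → y∈ }
  ... | no  ¬both     = _ , there (∈-⊖ y (∈-⊖ x (∈-filter⁺ (λ h → ¬? (x ∈? h ×-dec y ∈? h)) h∈ ¬both))) ,
                        without-⊆ ∘ without-⊆

pairs : Edge → List (Label × Label)
pairs []      = []
pairs (x ∷ h) = map (x ,_) h ++ pairs h

-- There are at most k disjoint pairs such that every edge contains one of them.
Paired : ℕ → Hypergraph → Set
Paired k       []      = ⊤
Paired zero    (h ∷ H) = ⊥
Paired (suc k) (h ∷ H) = Any (λ (x , y) → x ≢ y × Paired k ((h ∷ H) ⊘ (x , y))) (pairs h)

paired? : ∀ k H → Dec (Paired k H)
paired? k       []      = yes tt
paired? zero    (h ∷ H) = no λ ()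
paired? (suc k) (h ∷ H) = any? (λ (x , y) → ¬? (x ≟ y) ×-dec paired? k ((h ∷ H) ⊘ (x , y))) (pairs h)

paired⇒canS : ∀ k {H} → Paired k H → CanS k H
paired⇒canS k       {[]}    _ = canS-empty λ ()
paired⇒canS zero    {h ∷ H} ()
paired⇒canS (suc k) {h ∷ H} p with _ , _ , x≢y , q ← find p = canS-pair x≢y (paired⇒canS k q)

-- After at most n replies of Dominator a pairing strategy takes over.
Winnable : ℕ → ℕ → Hypergraph → Set
Winnable (suc n) (suc k) H = Paired (suc k) H ⊎ (¬ Short 0 H ×
  All (λ u → Any (λ v → Winnable n k (H ⊖ u ∖ v)) (support (H ⊖ u))) (support H))
Winnable _ k H = Paired k H

winnable? : ∀ n k H → Dec (Winnable n k H)
winnable? zero    k       H = paired? k H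
winnable? (suc n) zero    H = paired? zero H
winnable? (suc n) (suc k) H = paired? (suc k) H ⊎-dec (¬? (short? 0 H) ×-dec
  all? (λ u → any? (λ v → winnable? n k (H ⊖ u ∖ v)) (support (H ⊖ u))) (support H))

winnable⇒canS : ∀ n k {H} → Winnable n k H → CanS k H
winnable⇒canS zero    k       p        = paired⇒canS k p
winnable⇒canS (suc n) zero    p        = paired⇒canS zero p
winnable⇒canS (suc n) (suc k) (inj₁ p) = paired⇒canS (suc k) p
winnable⇒canS (suc n) (suc k) (inj₂ (¬s , p)) =
  canS-intro (λ i → ¬s (Any.map (λ { refl → z≤n }) i)) λ u∈ →
    let v , _ , q = find (All.lookup p u∈) in v , winnable⇒canS n k q

-- Sides of six columns

six : Bool → Hypergraph
six s = side s fresh 0 6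

-- This vertex lies in the only neighbourhood of its side that contains `mid`, so claiming it
-- detaches the side from `mid`.
key : Bool → Label
key s = at s 1 true

opaque
  unfolding _∖_ _⊖_ _without_ support

  six-mid : ∀ s → Paired 6 (six s ⊖ mid)
  six-mid true  = from-yes (paired? 6 (six true ⊖ mid))
  six-mid false = from-yes (paired? 6 (six false ⊖ mid))

  six∖key-mid : ∀ s → Winnable 2 3 (six s ∖ key s ⊖ mid)
  six∖key-mid true  = from-yes (winnable? 2 3 (six true ∖ key true ⊖ mid))
  six∖key-mid false = from-yes (winnable? 2 3 (six false ∖ key false ⊖ mid))

  -- The two corners lie in both outermost neighbourhoods and are paired off beforehand, which
  -- leaves a shorter search for the other five of six moves.
  six-key : ∀ s → Winnable 1 5 ((six s ⊖ key s) ⊘ (at s 5 false , at s 5 true))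
  six-key true  = from-yes (winnable? 1 5 ((six true ⊖ key true) ⊘ (at true 5 false , at true 5 true)))
  six-key false = from-yes (winnable? 1 5 ((six false ⊖ key false) ⊘ (at false 5 false , at false 5 true)))

  six-key-reply : ∀ s → Winnable 2 4 (six s ⊖ key s ∖ at s 2 false)
  six-key-reply true  = from-yes (winnable? 2 4 (six true ⊖ key true ∖ at true 2 false))
  six-key-reply false = from-yes (winnable? 2 4 (six false ⊖ key false ∖ at false 2 false))

  six-replies : ∀ s → All (λ u → u ≡ mid ⊎ u ≡ key s ⊎
    Any (λ v → Paired 4 (six s ⊖ u ∖ v ⊖ mid)) (support (six s))) (support (six s))
  six-replies true  = from-yes (all? (λ u → u ≟ mid ⊎-dec u ≟ key true ⊎-dec
    any? (λ v → paired? 4 (six true ⊖ u ∖ v ⊖ mid)) (support (six true))) (support (six true)))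
  six-replies false = from-yes (all? (λ u → u ≟ mid ⊎-dec u ≟ key false ⊎-dec
    any? (λ v → paired? 4 (six false ⊖ u ∖ v ⊖ mid)) (support (six false))) (support (six false)))

edges-nonempty : ∀ {s h} l → h ∈ edges s 0 l → h ≢ []
edges-nonempty {s} (suc l) h∈ with ∈-++⁻ (map (edge s l) (rows l)) h∈
... | inj₂ h∈ = edges-nonempty l h∈
... | inj₁ h∈ with r , _ , refl ← ∈-map⁻ (edge s l) h∈ = nonempty l
  where
  nonempty : ∀ l → edge s l r ≢ []
  nonempty zero    ()
  nonempty (suc l) ()

[]∉side : ∀ s e l → [] ∉ side s e 0 l
[]∉side s e (suc l) h∈ with ∈-++⁻ (map (end s l) (endRows e l)) h∈
... | inj₂ h∈ = edges-nonempty l h∈ refl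
... | inj₁ h∈ with r , _ , eq ← ∈-map⁻ (end s l) h∈ = nonempty l eq
  where
  nonempty : ∀ l → [] ≢ end s l r
  nonempty zero    ()
  nonempty (suc l) ()

canS-six : ∀ s → CanS 5 (six s)
canS-six s = canS-intro ([]∉side s fresh 6) λ {u} u∈ → reply u (All.lookup (six-replies s) u∈)
  where
  reply : ∀ u → _ → CanD 5 (six s ⊖ u)
  reply .mid     (inj₁ refl)        =
    key s , canS-mono (ℕ.n≤1+n 3) (∖⊖-comm λ ()) (winnable⇒canS 2 3 (six∖key-mid s))
  reply .(key s) (inj₂ (inj₁ refl)) = at s 2 false , winnable⇒canS 2 4 (six-key-reply s)
  reply u        (inj₂ (inj₂ p))    with v , _ , q ← find p =
    v , canS-mono ℕ.≤-refl (⊖-≼ mid) (paired⇒canS 4 q)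

infix 4 _⊑_

-- Serves only to bound the labels that can occur after some moves.
_⊑_ : Hypergraph → Hypergraph → Set
H ⊑ H′ = ∀ {h} → h ∈ H → ∃ λ h′ → h′ ∈ H′ × h ⊆ h′

⊑-refl : ∀ {H} → H ⊑ H
⊑-refl h∈ = _ , h∈ , id

⊖-⊑ : ∀ {H H′} u → H ⊑ H′ → H ⊖ u ⊑ H′
⊖-⊑ u p h∈ with h , i , refl ← ∈-⊖⁻ h∈ with h′ , j , s ← p i = h′ , j , s ∘ without-⊆

∖-⊑ : ∀ {H H′} v → H ⊑ H′ → H ∖ v ⊑ H′
∖-⊑ v p h∈ = p (proj₁ (∈-∖⁻ h∈))

-- Opposite sides have only `mid` in common, so it is enough that one of them gives it up.
sides-disjoint : ∀ {s t} m n {H₁ H₂} → s ≢ t → H₁ ⊑ side s fresh 0 m → H₂ ⊑ side t fresh 0 n →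
                 Disjoint (H₁ ⊖ mid) H₂
sides-disjoint m n s≢t p q {x} h₁∈ h₂∈ x∈₁ x∈₂
  with h , i , refl ← ∈-⊖⁻ h₁∈ with h₁ , j₁ , s₁ ← p i with h₂ , j₂ , s₂ ← q h₂∈ with x
... | mid      = ∉-without h x∈₁
... | at _ _ _ = s≢t (trans (sym (proj₁ (side-bound fresh m j₁ (s₁ (without-⊆ x∈₁)))))
                            (proj₁ (side-bound fresh n j₂ (s₂ x∈₂))))

∖-++ : ∀ H₁ H₂ v → (H₁ ∖ v) ++ H₂ ≼ (H₁ ++ H₂) ∖ v
∖-++ H₁ H₂ v h∈ with h∈ , v∉ ← ∈-∖⁻ h∈ with ∈-++⁻ H₁ h∈
... | inj₁ i = _ , ∈-++⁺ˡ (∈-∖ i v∉) , id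
... | inj₂ i = _ , ∈-++⁺ʳ (H₁ ∖ v) i , id

⊖-++ˡ : ∀ H₁ H₂ u → u ∉ support H₂ → (H₁ ⊖ u) ++ H₂ ≼ (H₁ ++ H₂) ⊖ u
⊖-++ˡ H₁ H₂ u u∉ h∈ with h , h∈ , refl ← ∈-⊖⁻ h∈ with ∈-++⁻ H₁ h∈
... | inj₁ i = _ , ∈-++⁺ˡ (∈-⊖ u i) , id
... | inj₂ i = h , ∈-++⁺ʳ (H₁ ⊖ u) i , λ x∈ → ∈-without x∈ λ { refl → u∉ (∈-support x∈ i) }

⊖-++² : ∀ H₁ H₂ u → (H₁ ⊖ u) ++ (H₂ ⊖ u) ≼ (H₁ ++ H₂) ⊖ u
⊖-++² H₁ H₂ u h∈ with h , h∈ , refl ← ∈-⊖⁻ h∈ with ∈-++⁻ H₁ h∈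
... | inj₁ i = _ , ∈-++⁺ˡ (∈-⊖ u i) , id
... | inj₂ i = _ , ∈-++⁺ʳ (H₁ ⊖ u) (∈-⊖ u i) , id

one-side : ∀ {s t} → s ≢ t → ∀ u → u ≢ mid → u ∈ support (six s) → u ∉ support (six t)
one-side s≢t mid        u≢mid _  _   = u≢mid refl
one-side {s} {t} s≢t (at _ _ _) _ u∈ u∈′
  with _ , x , i ← support⁻ (six s) u∈ with _ , y , j ← support⁻ (six t) u∈′ =
  s≢t (trans (sym (proj₁ (side-bound fresh 6 i x))) (proj₁ (side-bound fresh 6 j y)))

canD-side : ∀ {s t} → s ≢ t → ∀ {u} → u ≢ mid → u ∈ support (six s) → CanD 10 ((six s ++ six t) ⊖ u)
canD-side {s} {t} s≢t {u} u≢mid u∈ = canD-mono ℕ.≤-refl (⊖-++ˡ (six s) (six t) u (one-side s≢t u u≢mid u∈))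
                                         (reply (All.lookup (six-replies s) u∈))
  where
  reply : _ → CanD 10 ((six s ⊖ u) ++ six t)
  reply (inj₁ u≡mid)       = contradiction u≡mid u≢mid
  -- One move for `key t`, three more on side t without `mid`, and six on side s, which keeps `mid`:
  -- ten in all.
  reply (inj₂ (inj₁ refl)) = key t ,
    canS-mono ℕ.≤-refl (≼-trans (++-comm-≼ (six t ∖ key t ⊖ mid) (six s ⊖ key s))
                         (≼-trans (++-mono (≼-refl {six s ⊖ key s}) (⊖-≼ mid))
                         (≼-trans (++-comm-≼ (six s ⊖ key s) (six t ∖ key t))
                         (≼-trans (∖-++ (six t) (six s ⊖ key s) (key t))
                         (∖-mono (key t) (++-comm-≼ (six t) (six s ⊖ key s)))))))
      (canS-++ 3 6 (sides-disjoint 6 6 (s≢t ∘ sym) (∖-⊑ (key t) ⊑-refl) (⊖-⊑ (key s) ⊑-refl))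
        (winnable⇒canS 2 3 (six∖key-mid t)) (canS-pair (λ ()) (winnable⇒canS 1 5 (six-key s))))
  -- One move for v, four pairs on side s without `mid`, and five moves on side t with it.
  reply (inj₂ (inj₂ p)) with v , _ , q ← find p = v ,
    canS-mono ℕ.≤-refl (≼-trans (++-mono (⊖-≼ mid) (≼-refl {six t})) (∖-++ (six s ⊖ u) (six t) v))
      (canS-++ 4 5 (sides-disjoint 6 6 s≢t (∖-⊑ v (⊖-⊑ u ⊑-refl)) ⊑-refl) (paired⇒canS 4 q) (canS-six t))

canS-sixes : ∀ {s t} → s ≢ t → CanS 10 (six s ++ six t)
canS-sixes {s} {t} s≢t = canS-intro
  (λ i → [ []∉side s fresh 6 , []∉side t fresh 6 ] (∈-++⁻ (six s) i)) λ {u} u∈ → reply u (support⁻ (six s ++ six t) u∈)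
  where
  reply : ∀ u → (∃ λ h → u ∈ h × h ∈ six s ++ six t) → CanD 10 ((six s ++ six t) ⊖ u)
  reply u (h , x∈ , h∈) with u ≟ mid
  -- Either side could be chosen here. It takes one move and three more, while the other side,
  -- without `mid`, takes six pairs.
  ... | yes refl = key s ,
    canS-mono ℕ.≤-refl (≼-trans (++-mono {six s ∖ key s ⊖ mid} {six s ⊖ mid ∖ key s} (∖⊖-comm λ ()) (≼-refl {six t ⊖ mid}))
                         (≼-trans (∖-++ (six s ⊖ mid) (six t ⊖ mid) (key s)) (∖-mono (key s) (⊖-++² (six s) (six t) mid))))
      (canS-++ 3 6 (sides-disjoint 6 6 s≢t (∖-⊑ (key s) ⊑-refl) (⊖-⊑ mid ⊑-refl))
        (winnable⇒canS 2 3 (six∖key-mid s)) (paired⇒canS 6 (six-mid t)))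
  ... | no u≢mid with ∈-++⁻ (six s) h∈
  ...   | inj₁ i = canD-side s≢t u≢mid (∈-support x∈ i)
  ...   | inj₂ i = canD-mono ℕ.≤-refl (⊖-mono u (++-comm-≼ (six t) (six s)))
                     (canD-side (s≢t ∘ sym) u≢mid (∈-support x∈ i))

-- Adding further columns

end-bound : ∀ {s t x q} d {r} → at t x q ∈ end s d r → x ≤ d
end-bound zero    (here refl)                 = ℕ.≤-refl
end-bound zero    (there (here refl))         = ℕ.≤-refl
end-bound zero    (there (there (here ())))
end-bound (suc d) (here refl)                 = ℕ.≤-refl
end-bound (suc d) (there (here refl))         = ℕ.≤-refl
end-bound (suc d) (there (there (here refl))) = ℕ.n≤1+n d

-- The two vertices of the new column form the pair. Both new outermost neighbourhoods contain it,
-- and removing it from the neighbourhoods one column further in turns these into the old ends.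
canS-extend : ∀ {k s t} n m → s ≢ t → CanS k (side s fresh 0 n ++ side t fresh 0 (suc m)) →
              CanS (suc k) (side s fresh 0 n ++ side t fresh 0 (suc (suc m)))
canS-extend {k} {s} {t} n m s≢t = canS-pair (λ ()) ∘ canS-mono ℕ.≤-refl refine
  where
  x y : Label
  x = at t (suc m) false
  y = at t (suc m) true

  untouched : ∀ {h′ h : Edge} → (∀ {q} → at t (suc m) q ∉ h′) → h′ ⊆ h → h′ ⊆ h without x without y
  untouched ∉h′ s z∈ = ∈-without (∈-without (s z∈) λ { refl → ∉h′ z∈ }) λ { refl → ∉h′ z∈ }

  refine : side s fresh 0 n ++ side t fresh 0 (suc m) ≼ (side s fresh 0 n ++ side t fresh 0 (suc (suc m))) ⊘ (x , y)
  refine h∈ with h₁ , h∈ , refl ← ∈-⊖⁻ h∈ with h , h∈ , refl ← ∈-⊖⁻ h∈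
    with h∈ , ¬both ← ∈-filter⁻ (λ h → ¬? (x ∈? h ×-dec y ∈? h)) {xs = side s fresh 0 n ++ side t fresh 0 (suc (suc m))} h∈
    with ∈-++⁻ (side s fresh 0 n) h∈
  ... | inj₁ i = h , ∈-++⁺ˡ i , untouched (λ z∈ → s≢t (sym (proj₁ (side-bound fresh n i z∈)))) id
  ... | inj₂ (here refl)         = contradiction (here refl , there (here refl)) ¬both
  ... | inj₂ (there (here refl)) = contradiction (there (here refl) , here refl) ¬both
  ... | inj₂ (there (there i)) with ∈-++⁻ (map (edge t m) (rows m)) i
  ...   | inj₂ j = h , ∈-++⁺ʳ (side s fresh 0 n) (∈-++⁺ʳ (map (end t m) (rows m)) j) ,
                   untouched (λ z∈ → ℕ.1+n≰n (proj₂ (edges-bound m j z∈))) id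
  ...   | inj₁ j with r , r∈ , refl ← ∈-map⁻ (edge t m) j =
    end t m r , ∈-++⁺ʳ (side s fresh 0 n) (∈-++⁺ˡ (∈-map⁺ (end t m) r∈)) ,
    untouched (λ z∈ → ℕ.1+n≰n (end-bound m z∈)) (end⊆edge m)

canS-sides : ∀ {s t} → s ≢ t → ∀ e → CanS (10 + e) (side s fresh 0 6 ++ side t fresh 0 (6 + e))
canS-sides         s≢t zero    = canS-sixes s≢t
canS-sides {s} {t} s≢t (suc e) =
  subst (λ k → CanS k (side s fresh 0 6 ++ side t fresh 0 (6 + suc e))) (sym (ℕ.+-suc 10 e))
    (subst (λ m → CanS (11 + e) (side s fresh 0 6 ++ side t fresh 0 m)) (sym (ℕ.+-suc 6 e))
      (canS-extend 6 (5 + e) s≢t (canS-sides s≢t e)))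

-- Realisation on a graph

module Labelled {V : Set} (Adj : V → V → Set) (IsAt : Label → V → Set) (hub : V)
  (functional : ∀ {x u u′} → IsAt x u → IsAt x u′ → u ≡ u′)
  (injective  : ∀ {x x′ u} → IsAt x u → IsAt x′ u → x ≡ x′)
  (total      : ∀ u → u ≢ hub → ∃ λ x → IsAt x u) where

  open MBGame V Adj

  N : V → V → Set
  N c u = u ≡ c ⊎ Adj u c

  -- The edge h consists of the labels of the unclaimed vertices of N[c].
  record Link (D S : List V) (c : V) (h : Edge) : Set where
    field
      undominated : ∀ {u} → N c u → u ∉ D
      covered     : ∀ {u} → N c u → u ∈ S ⊎ ∃ λ x → x ∈ h × IsAt x u
      realised    : ∀ {x} → x ∈ h → ∃ λ u → N c u × u ∉ S × IsAt x u

  -- Edges and undominated vertices are only related, so no bijection has to be maintained. With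
  -- `hub` claimed by Dominator, every vertex that is still free carries a label.
  record Realises (D S : List V) (H : Hypergraph) : Set where
    field
      hub∈     : hub ∈ D
      disjoint : ∀ {u} → u ∈ D → u ∉ S
      sound    : ∀ {h} → h ∈ H → ∃ λ c → Link D S c h
      complete : ∀ c → (∃ λ u → u ∈ D × N c u) ⊎ ∃ λ h → h ∈ H × Link D S c h

  module _ {D S H} (R : Realises D S H) where
    open Realises R
    open Link

    ∉D⇒label : ∀ {u} → u ∉ D → ∃ λ x → IsAt x u
    ∉D⇒label {u} u∉ = total u λ { refl → u∉ hub∈ }

    staller-move : ∀ {u x} → u ∉ D → IsAt x u → Realises D (u ∷ S) (H ⊖ x)
    staller-move {u} {x} u∉D at-u = record
      { hub∈     = hub∈
      ; disjoint = λ { v∈ (here refl) → u∉D v∈ ; v∈ (there v∈S) → disjoint v∈ v∈S }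
      ; sound    = λ h∈ → let h , i , eq = ∈-⊖⁻ h∈ ; c , l = sound i in c , subst (Link D (u ∷ S) c) (sym eq) (link l)
      ; complete = λ c → complete′ (complete c)
      }
      where
      link : ∀ {c h} → Link D S c h → Link D (u ∷ S) c (h without x)
      link {c} {h} l = record
        { undominated = undominated l
        ; covered     = λ n → covered′ (covered l n)
        ; realised    = λ {y} y∈ → realised′ y∈ (realised l (without-⊆ y∈))
        }
        where
        covered′ : ∀ {v} → v ∈ S ⊎ (∃ λ y → y ∈ h × IsAt y v) → v ∈ u ∷ S ⊎ ∃ λ y → y ∈ h without x × IsAt y v
        covered′ (inj₁ v∈) = inj₁ (there v∈)
        covered′ (inj₂ (y , y∈ , at-v)) with y ≟ x
        ... | yes refl = inj₁ (here (functional at-v at-u))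
        ... | no  y≢x  = inj₂ (y , ∈-without y∈ y≢x , at-v)

        realised′ : ∀ {y} → y ∈ h without x → (∃ λ v → N c v × v ∉ S × IsAt y v) → ∃ λ v → N c v × v ∉ u ∷ S × IsAt y v
        realised′ y∈ (v , n , v∉ , at-v) = v , n , v∉u∷S , at-v
          where
          v∉u∷S : v ∉ u ∷ S
          v∉u∷S (here refl) with refl ← injective at-v at-u = ∉-without h y∈
          v∉u∷S (there v∈)  = v∉ v∈

      complete′ : ∀ {c} → (∃ λ u → u ∈ D × N c u) ⊎ (∃ λ h → h ∈ H × Link D S c h) →
                (∃ λ u → u ∈ D × N c u) ⊎ ∃ λ h → h ∈ H ⊖ x × Link D (u ∷ S) c h
      complete′ (inj₁ p)            = inj₁ p
      complete′ (inj₂ (h , h∈ , l)) = inj₂ (h without x , ∈-⊖ x h∈ , link l)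

    dominator-move : ∀ {v y} → v ∉ S → IsAt y v → Realises (v ∷ D) S (H ∖ y)
    dominator-move {v} {y} v∉S at-v = record
      { hub∈     = there hub∈
      ; disjoint = λ { (here refl) → v∉S ; (there u∈) → disjoint u∈ }
      ; sound    = λ h∈ → let i , y∉ = ∈-∖⁻ h∈ ; c , l = sound i in c , link y∉ l
      ; complete = λ c → complete′ (complete c)
      }
      where
      link : ∀ {c h} → y ∉ h → Link D S c h → Link (v ∷ D) S c h
      link {c} {h} y∉ l = record
        { undominated = λ { n (here refl) → missed (covered l n) ; n (there u∈) → undominated l n u∈ }
        ; covered     = covered l
        ; realised    = realised l
        }
        where
        missed : ¬ (v ∈ S ⊎ ∃ λ x → x ∈ h × IsAt x v)
        missed (inj₁ v∈) = v∉S v∈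
        missed (inj₂ (x , x∈ , at-v′)) with refl ← injective at-v′ at-v = y∉ x∈

      complete′ : ∀ {c} → (∃ λ u → u ∈ D × N c u) ⊎ (∃ λ h → h ∈ H × Link D S c h) →
                (∃ λ u → u ∈ v ∷ D × N c u) ⊎ ∃ λ h → h ∈ H ∖ y × Link (v ∷ D) S c h
      complete′ (inj₁ (u , u∈ , n)) = inj₁ (u , there u∈ , n)
      complete′ (inj₂ (h , h∈ , l)) with y ∈? h
      ... | no  y∉ = inj₂ (h , ∈-∖ h∈ y∉ , link y∉ l)
      ... | yes y∈ with u , n , _ , at-u ← realised l y∈ with refl ← functional at-u at-v = inj₁ (u , here refl , n)

    legal : ∀ {x h} → h ∈ H → x ∈ h → ∃ λ u → Unclaimed D S u × IsAt x u
    legal h∈ x∈ with c , l ← sound h∈ with u , n , u∉S , at-u ← realised l x∈ =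
      u , (undominated l n , u∉S) , at-u

    ¬stallerWon : [] ∉ H → ¬ StallerWon S
    ¬stallerWon []∉ (c , c∈ , nbrs) with complete c
    ... | inj₁ (u , u∈ , inj₁ refl) = disjoint u∈ c∈
    ... | inj₁ (u , u∈ , inj₂ adj)  = disjoint u∈ (nbrs u adj)
    ... | inj₂ ([] , h∈ , _) = []∉ h∈
    ... | inj₂ (x ∷ h , h∈ , l) with realised l (here refl)
    ...   | u , inj₁ refl , u∉ , _ = u∉ c∈
    ...   | u , inj₂ adj  , u∉ , _ = u∉ (nbrs u adj)

    stallerWon : [] ∈ H → StallerWon S
    stallerWon []∈ with c , l ← sound []∈ = c , claimed′ (covered l (inj₁ refl)) , λ u adj → claimed′ (covered l (inj₂ adj))
      where
      claimed′ : ∀ {u} → u ∈ S ⊎ (∃ λ x → x ∈ [] × IsAt x u) → u ∈ S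
      claimed′ (inj₁ u∈) = u∈

    ¬dominates : ∀ {h} → h ∈ H → ¬ Dominates D
    ¬dominates h∈ dom with c , l ← sound h∈ with dom c
    ... | inj₁ c∈            = undominated l (inj₁ refl) c∈
    ... | inj₂ (u , u∈ , adj) = undominated l (inj₂ adj) u∈

  dominates : ∀ {D S} → Realises D S [] → Dominates D
  dominates R c with Realises.complete R c
  ... | inj₁ (u , u∈ , inj₁ refl) = inj₁ u∈
  ... | inj₁ (u , u∈ , inj₂ adj)  = inj₂ (u , u∈ , adj)

  DWins : ℕ → List V → List V → Set
  DWins k D S = Dominates D ⊎ (∀ u → Unclaimed D S u → ¬ StallerWon (u ∷ S) × DWin k D (u ∷ S))

  mutual
    -- Staller's strategy may name a label off the support, which need not belong to a free vertex.
    -- She then claims a label of some edge instead, which is at least as good for her.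
    holdS⇒¬wins : ∀ k {D S H} → Realises D S H → HoldS k H → ¬ StallerWon S → ¬ DWins k D S
    holdS⇒¬wins k R ((_ , h∈) , _) _ (inj₁ dom) = ¬dominates R h∈ dom
    holdS⇒¬wins k {H = H} R ((h , h∈) , x , Q) ¬won (inj₂ win) with x ∈? support H
    ... | yes x∈ with h , x∈h , h∈ ← support⁻ H x∈ with u , (u∉D , u∉S) , at-u ← legal R h∈ x∈h
                 with ¬won′ , w ← win u (u∉D , u∉S) =
      holdD⇒¬DWin k (staller-move R u∉D at-u) Q ¬won′ w
    ... | no x∉ with h
    ...   | []    = ¬won (stallerWon R h∈)
    ...   | y ∷ _ with u , (u∉D , u∉S) , at-u ← legal R h∈ (here refl) with ¬won′ , w ← win u (u∉D , u∉S) =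
      holdD⇒¬DWin k (staller-move R u∉D at-u) (holdD-mono ℕ.≤-refl (≼-trans (⊖-≼ y) (⊖-∉-≼ x∉)) Q) ¬won′ w

    holdD⇒¬DWin : ∀ k {D S H} → Realises D S H → HoldD k H → ¬ StallerWon S → ¬ DWin k D S
    holdD⇒¬DWin (suc k) R (inj₁ []∈) ¬won _ = ¬won (stallerWon R []∈)
    holdD⇒¬DWin (suc k) R (inj₂ Q) ¬won (v , (v∉D , v∉S) , w) with y , at-v ← ∉D⇒label R v∉D =
      holdS⇒¬wins k (dominator-move R v∉S at-v) (Q y) ¬won w

  canS⇒wins : ∀ k {D S H} → Realises D S H → CanS k H → DWins k D S
  canS⇒wins k R (_ , inj₁ refl) = inj₁ (dominates R)
  canS⇒wins k {H = []} R (_ , inj₂ _) = inj₁ (dominates R)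
  canS⇒wins k {D} {S} {h₀ ∷ H} R (_ , inj₂ Q) = inj₂ reply
    where
    respond : ∀ k {u h H} → Realises D (u ∷ S) H → h ∈ H → CanD k H → ¬ StallerWon (u ∷ S) × DWin k D (u ∷ S)
    respond (suc k) {u} {h} {H} R h∈ (y , C@(∖∌[] , _)) = ¬stallerWon R []∉ , move h∈
      where
      []∉ : [] ∉ H
      -- An empty edge is never hit, so it would still be there after Dominator's move.
      []∉ i = ∖∌[] (∈-∖ i λ ())

      play : ∀ {y h} → CanS k (H ∖ y) → h ∈ H → y ∈ h → DWin (suc k) D (u ∷ S)
      play C h∈ y∈ with v , free , at-v ← legal R h∈ y∈ =
        v , free , canS⇒wins k (dominator-move R (proj₂ free) at-v) C

      move : ∀ {h} → h ∈ H → DWin (suc k) D (u ∷ S)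
      move h∈ with y ∈? support H
      ... | yes y∈ with h , y∈h , h∈ ← support⁻ H y∈ = play C h∈ y∈h
      move {[]}    []∈ | no y∉ = contradiction []∈ []∉
      -- The prescribed label hits nothing, so Dominator hits z instead and loses nothing by it.
      move {z ∷ _} h∈  | no y∉ = play (canS-mono ℕ.≤-refl (≼-trans (≼-∖-∉ y∉) (≼-∖ z)) C) h∈ (here refl)

    reply : ∀ u → Unclaimed D S u → ¬ StallerWon (u ∷ S) × DWin k D (u ∷ S)
    reply u (u∉D , u∉S) with x , at-u ← ∉D⇒label R u∉D =
      respond k (staller-move R u∉D at-u) (∈-⊖ x (here refl)) (Q x)

-- The grid with Dominator's first vertex in row i₀ and column c₀

module GridLabels (n : ℕ) (i₀ : Fin 2) (c₀ : Fin n) where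

  j : ℕ
  j = toℕ c₀

  size : Bool → ℕ
  size true  = j
  size false = n ∸ suc j

  -- Equations instead of truncated subtraction, with side `true` towards column 0.
  Column : Bool → ℕ → ℕ → Set
  Column true  d m = suc d + m ≡ j
  Column false d m = m ≡ suc d + j

  Row : Bool → Fin 2 → Set
  Row false i = i ≡ i₀
  Row true  i = i ≢ i₀

  IsAt : Label → GridV n → Set
  IsAt mid        (i , c) = Row true i × toℕ c ≡ j
  IsAt (at s d r) (i , c) = Row r i × Column s d (toℕ c)

  other : ∀ {i k l : Fin 2} → i ≢ l → k ≢ l → i ≡ k
  other {zero}     {zero}     p q = refl
  other {suc zero} {suc zero} p q = refl
  other {zero}     {suc zero} {zero}     p q = contradiction refl p
  other {zero}     {suc zero} {suc zero} p q = contradiction refl q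
  other {suc zero} {zero}     {zero}     p q = contradiction refl q
  other {suc zero} {zero}     {suc zero} p q = contradiction refl p

  row-functional : ∀ r {i k} → Row r i → Row r k → i ≡ k
  row-functional false refl refl = refl
  row-functional true  p    q    = other p q

  row-injective : ∀ r r′ {i} → Row r i → Row r′ i → r ≡ r′
  row-injective false false _ _ = refl
  row-injective true  true  _ _ = refl
  row-injective false true  p q = contradiction p q
  row-injective true  false p q = contradiction q p

  row-total : ∀ i → ∃ λ r → Row r i
  row-total i with i Fin.≟ i₀
  ... | yes p = false , p
  ... | no  p = true , p

  row-not : ∀ r {i k} → Row r i → k ≢ i → Row (not r) k
  row-not false refl k≢i = k≢i
  row-not true  i≢   k≢i with _ Fin.≟ i₀
  ... | yes k≡ = k≡
  ... | no  k≢ = contradiction (other k≢ i≢) k≢i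

  opposite : ∀ (i : Fin 2) → ∃ λ k → k ≢ i
  opposite zero       = suc zero , λ ()
  opposite (suc zero) = zero , λ ()

  column-functional : ∀ s d {m m′} → Column s d m → Column s d m′ → m ≡ m′
  column-functional true  d p q = ℕ.+-cancelˡ-≡ (suc d) _ _ (trans p (sym q))
  column-functional false d p q = trans p (sym q)

  column-injective : ∀ s s′ {d d′ m} → Column s d m → Column s′ d′ m → s ≡ s′ × d ≡ d′
  column-injective true  true  {m = m} p q = refl , ℕ.suc-injective (ℕ.+-cancelʳ-≡ m _ _ (trans p (sym q)))
  column-injective false false p q = refl , ℕ.suc-injective (ℕ.+-cancelʳ-≡ j _ _ (trans (sym p) q))
  column-injective true  false p q = contradiction (ℕ.<-trans (below p) (above q)) (ℕ.<-irrefl refl)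
    where
    below : ∀ {d m} → suc d + m ≡ j → m < j
    below {d} {m} p = subst (m <_) p (s≤s (ℕ.m≤n+m m d))
    above : ∀ {d m} → m ≡ suc d + j → j < m
    above {d} p = subst (j <_) (sym p) (s≤s (ℕ.m≤n+m j d))
  column-injective false true  p q with column-injective true false q p
  ... | ()

  column≢j : ∀ s {d m} → Column s d m → m ≢ j
  column≢j true  {d} {m} p m≡j = ℕ.<-irrefl m≡j (subst (m <_) p (s≤s (ℕ.m≤n+m m d)))
  column≢j false {d} {m} p m≡j = ℕ.<-irrefl (sym m≡j) (subst (j <_) (sym p) (s≤s (ℕ.m≤n+m j d)))

  column-total : ∀ (c : Fin n) → toℕ c ≢ j → ∃ λ s → ∃ λ d → Column s d (toℕ c)
  column-total c c≢ with ℕ.<-cmp (toℕ c) j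
  ... | tri< c<j _ _ = true , j ∸ suc (toℕ c) , trans (sym (ℕ.+-suc (j ∸ suc (toℕ c)) (toℕ c))) (ℕ.m∸n+n≡m c<j)
  ... | tri≈ _ c≡ _  = contradiction c≡ c≢
  ... | tri> _ _ j<c = false , toℕ c ∸ suc j , sym (trans (sym (ℕ.+-suc (toℕ c ∸ suc j) j)) (ℕ.m∸n+n≡m j<c))

  column-bound : ∀ s {d} (c : Fin n) → Column s d (toℕ c) → d < size s
  column-bound true  {d} c p = subst (suc d ≤_) p (ℕ.m≤m+n (suc d) (toℕ c))
  column-bound false {d} c p = ℕ.m+n≤o⇒m≤o∸n (suc d) (subst (_≤ n) (trans (cong suc p) (sym (ℕ.+-suc (suc d) j))) (Fin.toℕ<n c))

  column-exists : ∀ s {d} → d < size s → ∃ λ (c : Fin n) → Column s d (toℕ c)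
  column-exists true  {d} d<j = fromℕ< bound , trans (cong (suc d +_) (Fin.toℕ-fromℕ< bound)) (ℕ.m+[n∸m]≡n d<j)
    where
    bound : j ∸ suc d < n
    bound = ℕ.≤-<-trans (ℕ.m∸n≤m j (suc d)) (Fin.toℕ<n c₀)
  column-exists false {d} d<  = fromℕ< bound , Fin.toℕ-fromℕ< bound
    where
    bound : suc d + j < n
    bound = subst (_≤ n) (ℕ.+-suc (suc d) j) (ℕ.m≤o∸n⇒m+n≤o (suc d) (Fin.toℕ<n c₀) d<)

  Near : ℕ → ℕ → Set
  Near m m′ = suc m ≡ m′ ⊎ suc m′ ≡ m

  near-sym : ∀ {m m′} → Near m m′ → Near m′ m
  near-sym (inj₁ p) = inj₂ p
  near-sym (inj₂ p) = inj₁ p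

  near-hub : ∀ s {m} → Column s 0 m → Near m j
  near-hub true  p = inj₁ p
  near-hub false p = inj₂ (sym p)

  near-column : ∀ s {d m m′} → Column s (suc d) m → Column s d m′ → Near m m′
  near-column true  {d} {m} {m′} p q = inj₁ (ℕ.+-cancelˡ-≡ (suc d) _ _ (trans (ℕ.+-suc (suc d) m) (trans p (sym q))))
  near-column false p q = inj₂ (trans (cong suc q) (sym p))

  data Step (s : Bool) (d m : ℕ) : Set where
    outwards : Column s (suc d) m → Step s d m
    inwards  : ∀ {e} → d ≡ suc e → Column s e m → Step s d m
    tohub    : d ≡ 0 → m ≡ j → Step s d m

  step : ∀ s d {m m′} → Column s d m → Near m′ m → Step s d m′
  step true  d       p (inj₁ q) = outwards (trans (sym (ℕ.+-suc (suc d) _)) (trans (cong (suc d +_) q) p))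
  step true  zero    p (inj₂ q) = tohub refl (trans (sym q) p)
  step true  (suc d) p (inj₂ q) = inwards refl (trans (cong (suc d +_) (sym q)) (trans (ℕ.+-suc (suc d) _) p))
  step false d       p (inj₂ q) = outwards (trans (sym q) (cong suc p))
  step false zero    p (inj₁ q) = tohub refl (ℕ.suc-injective (trans q p))
  step false (suc d) p (inj₁ q) = inwards refl (ℕ.suc-injective (trans q p))

  hub : GridV n
  hub = i₀ , c₀

  functional : ∀ {x u u′} → IsAt x u → IsAt x u′ → u ≡ u′
  functional {mid}      (p , q) (p′ , q′) = cong₂ _,_ (other p p′) (Fin.toℕ-injective (trans q (sym q′)))
  functional {at s d r} (p , q) (p′ , q′) =
    cong₂ _,_ (row-functional r p p′) (Fin.toℕ-injective (column-functional s d q q′))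

  injective : ∀ {x x′ u} → IsAt x u → IsAt x′ u → x ≡ x′
  injective {mid}      {mid}         _       _         = refl
  injective {mid}      {at s _ _}    (_ , q) (_ , q′)  = contradiction q (column≢j s q′)
  injective {at s _ _} {mid}         (_ , q) (_ , q′)  = contradiction q′ (column≢j s q)
  injective {at s d r} {at s′ d′ r′} (p , q) (p′ , q′)
    with refl ← row-injective r r′ p p′ with refl , refl ← column-injective s s′ q q′ = refl

  total : ∀ u → u ≢ hub → ∃ λ x → IsAt x u
  total (i , c) u≢ with toℕ c ℕ.≟ j | row-total i
  ... | no  c≢ | r , p with s , d , q ← column-total c c≢ = at s d r , p , q
  total (i , c) u≢ | yes c≡ | true  , p = mid , p , c≡
  total (i , c) u≢ | yes c≡ | false , p = contradiction (cong₂ _,_ p (Fin.toℕ-injective c≡)) u≢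

  hub-unlabelled : ∀ {x} → ¬ IsAt x hub
  hub-unlabelled {mid}      (p , _) = p refl
  hub-unlabelled {at s _ _} (_ , q) = column≢j s q refl

  open Labelled (GridAdj n) IsAt hub functional injective total public

  record Neighbourhood (c : GridV n) (h : Edge) : Set where
    field
      all  : ∀ {u} → N c u → ∃ λ x → x ∈ h × IsAt x u
      only : ∀ {x} → x ∈ h → ∃ λ u → N c u × IsAt x u

  link : ∀ {c h} → Neighbourhood c h → Link (hub ∷ []) [] c h
  link nb = record
    { undominated = λ n → λ { (here refl) → hub-unlabelled (proj₂ (proj₂ (all n))) }
    ; covered     = λ n → inj₂ (all n)
    ; realised    = λ x∈ → let u , n , p = only x∈ in u , n , (λ ()) , p
    }
    where open Neighbourhood nb

  module _ (s : Bool) {r : Bool} {i : Fin 2} {c : Fin n} where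

    private
      across : ∀ d → Row r i → Column s d (toℕ c) → ∃ λ u → N (i , c) u × IsAt (at s d (not r)) u
      across d p q with k , k≢i ← opposite i = (k , c) , inj₂ (inj₂ (refl , k≢i)) , row-not r p k≢i , q

      beside : ∀ {c′} → Near (toℕ c′) (toℕ c) → N (i , c) (i , c′)
      beside near = inj₂ (inj₁ (refl , near))

    edge-all : ∀ d → r ∈ rows d → Row r i → Column s d (toℕ c) →
               ∀ {u} → N (i , c) u → ∃ λ x → x ∈ edge s d r × IsAt x u
    edge-all zero    _ p q (inj₁ refl)                = _ , here refl , p , q
    edge-all (suc d) _ p q (inj₁ refl)                = _ , here refl , p , q
    edge-all zero    _ p q (inj₂ (inj₂ (refl , k≢i))) = _ , there (here refl) , row-not r p k≢i , q
    edge-all (suc d) _ p q (inj₂ (inj₂ (refl , k≢i))) = _ , there (here refl) , row-not r p k≢i , q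
    edge-all d r∈ p q (inj₂ (inj₁ (refl , near))) with d | r∈ | step s d q near
    ... | zero  | _         | outwards q′     = _ , there (there (here refl)) , p , q′
    ... | suc _ | _         | outwards q′     = _ , there (there (here refl)) , p , q′
    ... | suc _ | _         | inwards refl q′ = _ , there (there (there (here refl))) , p , q′
    -- At distance 0 only row `true` is listed, and its neighbour in the column of the hub is `mid`,
    -- not the hub itself.
    ... | zero  | here refl | tohub _ q′      = _ , there (there (there (here refl))) , p , q′

    edge⇒end : ∀ d {x} → x ∈ edge s d r → x ∈ end s d r ⊎ x ≡ at s (suc d) r
    edge⇒end zero    (here p)                          = inj₁ (here p)
    edge⇒end zero    (there (here p))                  = inj₁ (there (here p))
    edge⇒end zero    (there (there (here p)))          = inj₂ p
    edge⇒end zero    (there (there (there (here p))))  = inj₁ (there (there (here p)))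
    edge⇒end (suc d) (here p)                          = inj₁ (here p)
    edge⇒end (suc d) (there (here p))                  = inj₁ (there (here p))
    edge⇒end (suc d) (there (there (here p)))          = inj₂ p
    edge⇒end (suc d) (there (there (there (here p))))  = inj₁ (there (there (here p)))

    end-only : ∀ d → r ∈ rows d → Row r i → Column s d (toℕ c) →
               ∀ {x} → x ∈ end s d r → ∃ λ u → N (i , c) u × IsAt x u
    end-only zero    _           p q (here refl)                 = _ , inj₁ refl , p , q
    end-only (suc d) _           p q (here refl)                 = _ , inj₁ refl , p , q
    end-only zero    _           p q (there (here refl))         = across zero p q
    end-only (suc d) _           p q (there (here refl))         = across (suc d) p q
    end-only zero    (here refl) p q (there (there (here refl))) =
      (i , c₀) , beside (near-sym (near-hub s q)) , p , refl
    end-only (suc d) _           p q (there (there (here refl)))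
      with c′ , q′ ← column-exists s (ℕ.<⇒≤ (column-bound s c q)) =
      (i , c′) , beside (near-sym (near-column s q q′)) , p , q′

    edge-neighbourhood : ∀ d → r ∈ rows d → Row r i → Column s d (toℕ c) → suc d < size s →
                         Neighbourhood (i , c) (edge s d r)
    edge-neighbourhood d r∈ p q 1+d< = record { all = edge-all d r∈ p q ; only = only ∘ edge⇒end d }
      where
      only : ∀ {x} → x ∈ end s d r ⊎ x ≡ at s (suc d) r → ∃ λ u → N (i , c) u × IsAt x u
      only (inj₁ x∈)   = end-only d r∈ p q x∈
      only (inj₂ refl) with c′ , q′ ← column-exists s 1+d< = (i , c′) , beside (near-column s q′ q) , p , q′

    -- Here the outward label would lie beyond the grid, so it names no vertex.
    end-neighbourhood : ∀ d → r ∈ rows d → Row r i → Column s d (toℕ c) → suc d ≡ size s →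
                        Neighbourhood (i , c) (end s d r)
    end-neighbourhood d r∈ p q 1+d≡ = record { all = all ; only = end-only d r∈ p q }
      where
      all : ∀ {u} → N (i , c) u → ∃ λ x → x ∈ end s d r × IsAt x u
      all n with x , x∈ , at-u ← edge-all d r∈ p q n with edge⇒end d x∈
      ... | inj₁ x∈   = x , x∈ , at-u
      ... | inj₂ refl = contradiction (subst (_< size s) 1+d≡ (column-bound s _ (proj₂ at-u))) (ℕ.<-irrefl refl)

  row-exists : ∀ r → ∃ λ i → Row r i
  row-exists false = i₀ , refl
  row-exists true  = opposite i₀

  initial : Hypergraph
  initial = side true fresh 0 j ++ side false fresh 0 (n ∸ suc j)

  edges-sound : ∀ s l {h} → l < size s → h ∈ edges s 0 l → ∃ λ c → Neighbourhood c h
  edges-sound s (suc l) l< h∈ with ∈-++⁻ (map (edge s l) (rows l)) h∈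
  ... | inj₂ h∈ = edges-sound s l (ℕ.<⇒≤ l<) h∈
  ... | inj₁ h∈ with r , r∈ , refl ← ∈-map⁻ (edge s l) h∈
                with i , p ← row-exists r | c , q ← column-exists s (ℕ.<⇒≤ l<) =
    (i , c) , edge-neighbourhood s l r∈ p q l<

  side-sound : ∀ s l {h} → l ≡ size s → h ∈ side s fresh 0 l → ∃ λ c → Neighbourhood c h
  side-sound s (suc l) eq h∈ with ∈-++⁻ (map (end s l) (rows l)) h∈
  ... | inj₂ h∈ = edges-sound s l (ℕ.≤-reflexive eq) h∈
  ... | inj₁ h∈ with r , r∈ , refl ← ∈-map⁻ (end s l) h∈
                with i , p ← row-exists r | c , q ← column-exists s (ℕ.≤-reflexive eq) =
    (i , c) , end-neighbourhood s l r∈ p q eq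

  edges-complete : ∀ s {i c r} d l → d < l → l < size s → r ∈ rows d → Row r i → Column s d (toℕ c) →
                   ∃ λ h → h ∈ edges s 0 l × Neighbourhood (i , c) h
  edges-complete s d (suc l) d<l l< r∈ p q with ℕ.m≤n⇒m<n∨m≡n (s≤s⁻¹ d<l)
  ... | inj₁ d<l with h , h∈ , nb ← edges-complete s d l d<l (ℕ.<⇒≤ l<) r∈ p q =
    h , ∈-++⁺ʳ (map (edge s l) (rows l)) h∈ , nb
  ... | inj₂ refl = _ , ∈-++⁺ˡ (∈-map⁺ (edge s l) r∈) , edge-neighbourhood s l r∈ p q l<

  side-complete : ∀ s {i c r} d l → l ≡ size s → r ∈ rows d → Row r i → Column s d (toℕ c) →
                  ∃ λ h → h ∈ side s fresh 0 l × Neighbourhood (i , c) h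
  side-complete s {c = c} d zero    eq r∈ p q with subst (d <_) (sym eq) (column-bound s c q)
  ... | ()
  side-complete s {c = c} d (suc l) eq r∈ p q with ℕ.m≤n⇒m<n∨m≡n (s≤s⁻¹ (subst (d <_) (sym eq) (column-bound s c q)))
  ... | inj₁ d<l with h , h∈ , nb ← edges-complete s d l d<l (ℕ.≤-reflexive eq) r∈ p q =
    h , ∈-++⁺ʳ (map (end s l) (rows l)) h∈ , nb
  ... | inj₂ refl = _ , ∈-++⁺ˡ (∈-map⁺ (end s l) r∈) , end-neighbourhood s l r∈ p q eq

  realises-initial : Realises (hub ∷ []) [] initial
  realises-initial = record
    { hub∈     = here refl
    ; disjoint = λ _ ()
    ; sound    = λ h∈ → let c , nb = sound h∈ in c , link nb
    ; complete = complete
    }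
    where
    sound : ∀ {h} → h ∈ initial → ∃ λ c → Neighbourhood c h
    sound h∈ with ∈-++⁻ (side true fresh 0 j) h∈
    ... | inj₁ h∈ = side-sound true j refl h∈
    ... | inj₂ h∈ = side-sound false (n ∸ suc j) refl h∈

    in-initial : ∀ s {h} → h ∈ side s fresh 0 (size s) → h ∈ initial
    in-initial true  h∈ = ∈-++⁺ˡ h∈
    in-initial false h∈ = ∈-++⁺ʳ (side true fresh 0 j) h∈

    linked : ∀ s {c} → (∃ λ h → h ∈ side s fresh 0 (size s) × Neighbourhood c h) →
      (∃ λ u → u ∈ hub ∷ [] × N c u) ⊎ ∃ λ h → h ∈ initial × Link (hub ∷ []) [] c h
    linked s (h , h∈ , nb) = inj₂ (h , in-initial s h∈ , link nb)

    beside-hub : ∀ s d r {i c} → Row r i → Column s d (toℕ c) →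
      (∃ λ u → u ∈ hub ∷ [] × N (i , c) u) ⊎ ∃ λ h → h ∈ initial × Link (hub ∷ []) [] (i , c) h
    beside-hub s zero false refl q = inj₁ (hub , here refl , inj₂ (inj₁ (refl , near-sym (near-hub s q))))
    beside-hub s zero true  p q = linked s (side-complete s zero (size s) refl (here refl) p q)
    beside-hub s (suc d) r  p q = linked s (side-complete s (suc d) (size s) refl (row∈ r) p q)
      where
      row∈ : ∀ r → r ∈ rows (suc d)
      row∈ false = here refl
      row∈ true  = there (here refl)

    complete : ∀ c → (∃ λ u → u ∈ hub ∷ [] × N c u) ⊎ ∃ λ h → h ∈ initial × Link (hub ∷ []) [] c h
    complete (i , c) with toℕ c ℕ.≟ j
    ... | yes c≡ with i Fin.≟ i₀
    ...   | yes refl = inj₁ (hub , here refl , inj₁ (cong (i₀ ,_) (sym (Fin.toℕ-injective c≡))))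
    ...   | no  i≢   = inj₁ (hub , here refl , inj₂ (inj₂ (sym (Fin.toℕ-injective c≡) , i≢ ∘ sym)))
    complete (i , c) | no c≢ with s , d , q ← column-total c c≢ with r , p ← row-total i = beside-hub s d r p q

-- The two bounds

module _ (n : ℕ) where
  open MBGame (GridV n) (GridAdj n)

  dominator-needs : ∀ k → DWin k [] [] → n ∸ 2 ≤ k
  dominator-needs (suc k) ((i , c) , _ , wins) = ℕ.≮⇒≥ λ k<n∸2 →
    holdS⇒¬wins k realises-initial (held _ fresh j fresh (n ∸ suc j) ℕ.≤-refl (enough k<n∸2) λ ())
      (λ ()) wins
    where
    open GridLabels n i c

    -- The opening takes one of the k + 1 moves and one of the n columns, so k + 4 ≤ n leaves k + 3
    -- ≤ n - 1.
    enough : suc k < n ∸ 2 → k + 3 ≤ j + (n ∸ suc j)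
    enough k<n∸2 = s≤s⁻¹ (begin
      suc (k + 3)             ≡⟨ ℕ.+-suc (suc k) 2 ⟩
      suc (suc k) + 2         ≤⟨ ℕ.+-monoˡ-≤ 2 k<n∸2 ⟩
      n ∸ 2 + 2               ≡⟨ ℕ.m∸n+n≡m 2≤n ⟩
      n                       ≡⟨ ℕ.m+[n∸m]≡n (Fin.toℕ<n c) ⟨
      suc (j + (n ∸ suc j))   ∎)
      where
      open ℕ.≤-Reasoning
      2≤n : 2 ≤ n
      2≤n = ℕ.<⇒≤ (ℕ.m∸n≢0⇒n<m (ℕ.m<n⇒n≢0 k<n∸2))

-- Column index 6 leaves six columns on one side and 6 + e on the other; the opening adds one to the
-- 10 + e moves needed there.
dominator-suffices : ∀ e → MBGame.DWin (GridV (13 + e)) (GridAdj (13 + e)) (11 + e) [] []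
dominator-suffices e = hub , ((λ ()) , λ ()) , canS⇒wins (10 + e) realises-initial (canS-sides (λ ()) e)
  where open GridLabels (13 + e) zero (suc (suc (suc (suc (suc (suc zero))))))

theorem5 : ∀ (n : ℕ) → 13 ≤ n → γMB-P2□P-is n (n ∸ 2)
theorem5 n 13≤n with e , refl ← ℕ.m≤n⇒∃[o]m+o≡n 13≤n = dominator-suffices e , dominator-needs n
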